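{- For all integers $r,s,t$ with $1\le r\le s$ and $t\ge 2$, $$\chi_r(W(s,t))=t+2(r-1).$$
   Context: Graphs are finite, simple and undirected. For positive integers $s,t$ the graph $W(s,t)$ has vertex set consisting of all sequences $(x_1,\dots,x_t)$ with $x_i\in\{0,1,\dots,s\}$ for all $i$, such that there is exactly one index $i$ with $x_i=0$ and at least one index $j$ with $x_j=1$. Two vertices $(x_1,\dots,x_t)$ and $(y_1,\dots,y_t)$ are adjacent if and only if for every $i$ either $|x_i-y_i|=1$ or $x_i=y_i=s$. For a graph $G$ and a positive integer $r$, the $r$-fold chromatic number ($r$-th multichromatic number) $\chi_r(G)$ is the minimum $n$ such that one can assign to each vertex of $G$ a set of exactly $r$ distinct colors from $\{1,\dots,n\}$ in such a way that adjacent vertices receive disjoint sets. (Equivalently, $G$ admits a homomorphism to the Kneser graph whose vertices are the $r$-element subsets of $\{1,\dots,n\}$, two being adjacent if and only if they are disjoint.) -}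

module Defs where

open import Data.Fin using (Fin; toℕ)
open import Data.Fin.Properties using (any?; all?) renaming (_≟_ to _≟ᶠ_)
open import Data.Fin.Subset using (Subset; Empty; _∩_; ∣_∣)
open import Data.Irrelevant using ([_])
open import Data.List using (List; []; _∷_; allFin; cartesianProductWith)
open import Data.List.Membership.Propositional using (_∈_)
open import Data.List.Membership.Propositional.Properties
  using (∈-allFin; ∈-cartesianProductWith⁺)
open import Data.List.Relation.Unary.Any using (here; there)
open import Data.Nat using (ℕ; zero; suc; _≤_; _≟_; ∣_-_∣)
open import Data.Nat.Properties using (∣-∣-comm; ∣n-n∣≡0; 0≢1+n)
open import Data.Product using (∃-syntax; ∃!; _×_; _,_)
open import Data.Refinement using (Refinement-syntax; _,_; value)
open import Data.Sum using (_⊎_; inj₁; inj₂; map)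
open import Data.Vec using (Vec; []; _∷_; lookup)
open import Function using (_on_)
open import Relation.Binary using (Rel; Decidable; Irreflexive; Symmetric)
open import Relation.Binary.PropositionalEquality using (_≡_; refl; sym; trans)
open import Relation.Nullary using (¬_; Dec; yes; no; _×-dec_; _⊎-dec_; _→-dec_)
open import Relation.Nullary.Decidable using (map′)
open import Relation.Nullary.Negation using (contradiction; contradiction-irr)

record Graph : Set₁ where
  infix 4 _~_ _~?_
  field
    Vertex      : Set
    _~_         : Rel Vertex _
    ~-sym       : Symmetric _~_
    ~-irrefl    : Irreflexive _≡_ _~_
    _~?_        : Decidable _~_
    vertices    : List Vertex
    ∈-vertices  : ∀ v → v ∈ vertices

record Multicolouring (G : Graph) (r n : ℕ) : Set where
  open Graph G
  field
    colours  : Vertex → Subset n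
    size     : ∀ v → ∣ colours v ∣ ≡ r
    disjoint : ∀ {u v} → u ~ v → Empty (colours u ∩ colours v)

-- χᵣ(G) = n, as a relation between G, r and n.
record MultichromaticNumber (G : Graph) (r n : ℕ) : Set where
  field
    attained : Multicolouring G r n
    minimal  : ∀ m → Multicolouring G r m → n ≤ m

Sequence : ℕ → ℕ → Set
Sequence s t = Vec (Fin (suc s)) t

module _ {s t : ℕ} where

  infix 8 _at_
  _at_ : Sequence s t → Fin t → ℕ
  x at i = toℕ (lookup x i)

  UniqueZero : Sequence s t → Set
  UniqueZero x = ∃! _≡_ λ i → x at i ≡ 0

  HasOne : Sequence s t → Set
  HasOne x = ∃[ j ] x at j ≡ 1

  IsVertex : Sequence s t → Set
  IsVertex x = UniqueZero x × HasOne x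

  Adjacent : Rel (Sequence s t) _
  Adjacent x y = ∀ i → ∣ x at i - y at i ∣ ≡ 1 ⊎ (x at i ≡ s × y at i ≡ s)

  isVertex? : ∀ x → Dec (IsVertex x)
  isVertex? x = uniqueZero? ×-dec any? λ j → x at j ≟ 1
    where
    uniqueZero? : Dec (UniqueZero x)
    uniqueZero? = any? λ i → (x at i ≟ 0) ×-dec
      map′ (λ f {j} → f j) (λ f j → f {j})
           (all? λ j → (x at j ≟ 0) →-dec (i ≟ᶠ j))

  adjacent? : Decidable Adjacent
  adjacent? x y = all? λ i →
    (∣ x at i - y at i ∣ ≟ 1) ⊎-dec ((x at i ≟ s) ×-dec (y at i ≟ s))

  adjacent-sym : Symmetric Adjacent
  adjacent-sym {x} {y} p i = map
    (trans (∣-∣-comm (y at i) (x at i)))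
    (λ (xᵢ≡s , yᵢ≡s) → yᵢ≡s , xᵢ≡s) (p i)

  -- A sequence adjacent to itself is constantly s, so it cannot contain
  -- both 0 and 1.
  adjacent-irrefl : ∀ {x} → Adjacent x x → ¬ IsVertex x
  adjacent-irrefl {x} p ((i , xᵢ≡0 , _) , (j , xⱼ≡1)) =
    0≢1+n (trans (sym xᵢ≡0) (trans (constant i) (trans (sym (constant j)) xⱼ≡1)))
    where
    constant : ∀ k → x at k ≡ s
    constant k with p k
    ... | inj₁ ∣xₖ-xₖ∣≡1 =
      contradiction (trans (sym (∣n-n∣≡0 (x at k))) ∣xₖ-xₖ∣≡1) 0≢1+n
    ... | inj₂ (xₖ≡s , _) = xₖ≡s

-- Membership in the vertex set is proof-irrelevant, so that vertices are
-- equal as soon as they are equal as sequences.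
WVertex : ℕ → ℕ → Set
WVertex s t = [ x ∈ Sequence s t ∣ IsVertex x ]

sequences : ∀ s t → List (Sequence s t)
sequences s zero    = [] ∷ []
sequences s (suc t) = cartesianProductWith _∷_ (allFin (suc s)) (sequences s t)

∈-sequences : ∀ {s t} (x : Sequence s t) → x ∈ sequences s t
∈-sequences []      = here refl
∈-sequences (a ∷ x) = ∈-cartesianProductWith⁺ _∷_ (∈-allFin a) (∈-sequences x)

module _ {s t : ℕ} where

  selectVertices : List (Sequence s t) → List (WVertex s t)
  selectVertices []       = []
  selectVertices (x ∷ xs) with isVertex? x
  ... | yes p = (x , [ p ]) ∷ selectVertices xs
  ... | no _  = selectVertices xs

  ∈-selectVertices : ∀ (v : WVertex s t) {xs} → value v ∈ xs → v ∈ selectVertices xs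
  ∈-selectVertices (x , [ p ]) {y ∷ _} (here refl) with isVertex? y
  ... | yes _ = here refl
  ... | no ¬p = contradiction-irr p ¬p
  ∈-selectVertices v {y ∷ _} (there v∈xs) with isVertex? y
  ... | yes _ = there (∈-selectVertices v v∈xs)
  ... | no _  = ∈-selectVertices v v∈xs

W : ℕ → ℕ → Graph
W s t = record
  { Vertex     = WVertex s t
  ; _~_        = Adjacent on value
  ; ~-sym      = λ {u} {v} → adjacent-sym {x = value u} {value v}
  ; ~-irrefl   = λ { {x , [ p ]} refl x~x → contradiction-irr p (adjacent-irrefl {x = x} x~x) }
  ; _~?_       = λ u v → adjacent? (value u) (value v)
  ; vertices   = selectVertices (sequences s t)
  ; ∈-vertices = λ v → ∈-selectVertices v (∈-sequences (value v))
  }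

{-# OPTIONS --safe #-}
module Submission where

-- Lower bound.  Colouring an r-set A ⊆ {1,…,n} by min(min A, n − 2r + 2) is a
-- proper colouring of the Kneser graph, so it is enough that W(s,t) has no
-- proper colouring with fewer than t colours.  Unrolling every coordinate into
-- the path 0 … 2s+1 turns the two copies of the vertex set in the bipartite
-- double cover of W(s,t) into the points of {0,…,s}^t with a single 0 and at
-- least one s, and those with a single s and at least one 0; p and q are then
-- adjacent iff p ≤ q ≤ p + 1 coordinatewise.  The points having both a 0 and an
-- s form a triangulated (t−2)-sphere.  A colouring labels its suspension by
-- signed colours without complementary edges, and Fan's lemma gives a simplex
-- whose t labels alternate in sign, hence have t different colours.
--
-- Upper bound.  Put ρᵢ = min(r, x₀, …, xᵢ₋₁) and give x the colours i − k with
-- 2xᵢ ≤ k ≤ 2ρᵢ − 2 and ⌊k/2⌋ ≡ xᵢ mod 2.  Position i contributes ρᵢ − ρᵢ₊₁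
-- of them, hence r in total.  If i − k = j − l is a colour of both x and y
-- with i < j, then 2xᵢ ≤ k < l ≤ 2yᵢ − 2, so that x and y are not adjacent; and
-- if i = j, then xᵢ and yᵢ are less than s and have the same parity.

open import Algebra using (CommutativeRing)
import Algebra.Properties.CommutativeMonoid.Sum as Sum
open import Data.Bool using (Bool; true; false; not; _∧_; _∨_; _xor_)
open import Data.Bool.Properties
  using (xor-∧-commutativeRing; xor-same; xor-identityʳ; xor-comm; xor-assoc;
         not-involutive; ∧-zeroʳ; ¬-not; T-≡)
open import Data.Bool.Solver using (module xor-∧-Solver)
open import Data.Empty using (⊥)
open import Data.Fin using (Fin; zero; suc; toℕ; fromℕ; fromℕ<; inject₁; opposite)
open import Data.Fin.Permutation using () renaming (reverse to reversePermutation)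
open import Data.Fin.Properties
  using (opposite-involutive; opposite-prop; toℕ-inject₁; toℕ-fromℕ; toℕ-fromℕ<;
         toℕ≤pred[n]; toℕ-injective)
open import Data.Fin.Subset using (Subset; Empty; _∩_; ∣_∣; _∈_)
open import Data.Fin.Subset.Properties using (x∈p∩q⁻; drop-∷-Empty)
open import Data.Irrelevant using ([_])
open import Data.List
  using (List; []; _∷_; _∷ʳ_; length; map; reverse; null; replicate)
open import Data.List.Properties
  using (map-++; map-cong; map-id; map-∘; unfold-reverse; reverse-map;
         reverse-involutive; length-map; length-reverse; length-replicate)
open import Data.List.Relation.Binary.Permutation.Propositional as ↭ using (_↭_)
open import Data.List.Relation.Binary.Permutation.Propositional.Properties
  using (↭-length; ↭-reverse)
open import Data.List.Relation.Unary.All as All using (All; []; _∷_)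
import Data.List.Relation.Unary.All.Properties as Allₚ
open import Data.List.Relation.Unary.AllPairs as AllPairs using (AllPairs; []; _∷_)
import Data.List.Relation.Unary.AllPairs.Properties as AllPairsₚ
open import Data.Nat
open import Data.Nat.Properties
open import Data.Product using (∃-syntax; _×_; _,_; proj₁; proj₂)
open import Data.Refinement using (value; _,_)
open import Data.Sum using (_⊎_; inj₁; inj₂)
open import Data.Unit using (⊤; tt)
open import Data.Vec as Vec using ([]; _∷_; lookup; tabulate; here)
open import Data.Vec.Properties using (lookup-map; lookup∘tabulate; []=⇒lookup)
open import Defs
open import Function using (_∘_; const; id; flip; Equivalence)
open import Relation.Binary using (tri<; tri≈; tri>)
open import Relation.Binary.PropositionalEquality
open import Relation.Nullary using (¬_; yes; no; contradiction)
open import Relation.Nullary.Decidable using (recompute)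

open xor-∧-Solver using (solve; _:+_; _:=_)
open Sum (CommutativeRing.+-commutativeMonoid xor-∧-commutativeRing)
  using (sum; sum-cong-≗; ∑-distrib-+; sum-permute; sum-replicate-zero)

-- Cochains modulo 2 on ordered simplices

private variable
  A B : Set

Cochain : Set → Set
Cochain A = List A → Bool

infixl 6 _⊞_
_⊞_ : Cochain A → Cochain A → Cochain A
(F ⊞ G) σ = F σ xor G σ

δ : Cochain A → Cochain A
δ F []      = false
δ F (x ∷ σ) = F σ xor δ (F ∘ (x ∷_)) σ

δ-cong : {F G : Cochain A} → F ≗ G → δ F ≗ δ G
δ-cong e []      = refl
δ-cong e (x ∷ σ) = cong₂ _xor_ (e σ) (δ-cong (e ∘ (x ∷_)) σ)

xor-leftComm : ∀ a b c → a xor (b xor c) ≡ b xor (a xor c)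
xor-leftComm = solve 3 (λ a b c → a :+ (b :+ c) := b :+ (a :+ c)) refl

interchange : ∀ a b c d → (a xor b) xor (c xor d) ≡ (a xor c) xor (b xor d)
interchange = solve 4 (λ a b c d → (a :+ b) :+ (c :+ d) := (a :+ c) :+ (b :+ d)) refl

δ-⊞ : (F G : Cochain A) → δ (F ⊞ G) ≗ δ F ⊞ δ G
δ-⊞ F G []      = refl
δ-⊞ F G (x ∷ σ) = trans
  (cong ((F σ xor G σ) xor_) (δ-⊞ (F ∘ (x ∷_)) (G ∘ (x ∷_)) σ))
  (interchange (F σ) (G σ) _ _)

δ-false : δ {A} (const false) ≗ const false
δ-false []      = refl
δ-false (x ∷ σ) = δ-false σ

δ-map : (f : A → B) (F : Cochain B) → δ (F ∘ map f) ≗ δ F ∘ map f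
δ-map f F []      = refl
δ-map f F (x ∷ σ) = cong (F (map f σ) xor_) (δ-map f (F ∘ (f x ∷_)) σ)

δ-∷ʳ : (F : Cochain A) (σ : List A) (x : A) →
  δ F (σ ∷ʳ x) ≡ F σ xor δ (F ∘ (_∷ʳ x)) σ
δ-∷ʳ F []      x = refl
δ-∷ʳ F (y ∷ σ) x = trans
  (cong (F (σ ∷ʳ x) xor_) (δ-∷ʳ (F ∘ (y ∷_)) σ x))
  (xor-leftComm (F (σ ∷ʳ x)) (F (y ∷ σ)) _)

-- A list read backwards has the same faces, and modulo 2 no sign records the order.
δ-reverse : (F : Cochain A) → δ (F ∘ reverse) ≗ δ F ∘ reverse
δ-reverse F []      = refl
δ-reverse F (x ∷ σ) = begin
  F (reverse σ) xor δ (λ τ → F (reverse (x ∷ τ))) σ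
    ≡⟨ cong (F (reverse σ) xor_) (δ-cong (cong F ∘ unfold-reverse x) σ) ⟩
  F (reverse σ) xor δ (λ τ → F (reverse τ ∷ʳ x)) σ
    ≡⟨ cong (F (reverse σ) xor_) (δ-reverse (F ∘ (_∷ʳ x)) σ) ⟩
  F (reverse σ) xor δ (F ∘ (_∷ʳ x)) (reverse σ)
    ≡⟨ δ-∷ʳ F (reverse σ) x ⟨
  δ F (reverse σ ∷ʳ x)
    ≡⟨ cong (δ F) (unfold-reverse x σ) ⟨
  δ F (reverse (x ∷ σ)) ∎
  where open ≡-Reasoning

-- Dual of the prism operator: the sum over i of F at
-- (a,x₀) … (a,xᵢ) (b,xᵢ) … (b,xₖ).
prism : B → B → Cochain (B × A) → Cochain A
prism a b F []      = false
prism a b F (x ∷ σ) =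
  F ((a , x) ∷ map (b ,_) (x ∷ σ)) xor prism a b (F ∘ ((a , x) ∷_)) σ

prism-cong : ∀ (a b : B) {F G : Cochain (B × A)} → F ≗ G → prism a b F ≗ prism a b G
prism-cong a b e []      = refl
prism-cong a b e (x ∷ σ) =
  cong₂ _xor_ (e _) (prism-cong a b (e ∘ ((a , x) ∷_)) σ)

prism-⊞ : ∀ (a b : B) (F G : Cochain (B × A)) → prism a b (F ⊞ G) ≗ prism a b F ⊞ prism a b G
prism-⊞ a b F G []      = refl
prism-⊞ a b F G (x ∷ σ) = trans
  (cong ((F aσ xor G aσ) xor_) (prism-⊞ a b (F ∘ ((a , x) ∷_)) (G ∘ ((a , x) ∷_)) σ))
  (interchange (F aσ) (G aσ) _ _)
  where aσ = (a , x) ∷ map (b ,_) (x ∷ σ)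

-- The homotopy formula of the prism. Dropping `(b , xᵢ)` from one simplex and `(a , xᵢ₊₁)` from the
-- next leaves the same face, so inner faces cancel. The walls give `δ (prism a b F)`, and the
-- bottom and the top remain.
prism-δ : ∀ (a b : B) (F : Cochain (B × A)) →
  prism a b (δ F) ⊞ δ (prism a b F) ≗ F ∘ map (a ,_) ⊞ F ∘ map (b ,_)
prism-δ a b F []      = sym (xor-same (F []))
prism-δ {B} {A} a b F (x ∷ σ) = begin
  ((F bxσ xor (Fₐ bσ xor δ (Fₐ ∘ ((b , x) ∷_)) bσ)) xor prism a b (λ τ → F τ xor δ Fₐ τ) σ)
    xor (prism a b F σ xor δ (λ τ → Fₐ (map (b ,_) (x ∷ τ)) xor prism a b Fₐ τ) σ)
    ≡⟨ cong₂ (λ u v → ((F bxσ xor (Fₐ bσ xor δ (Fₐ ∘ ((b , x) ∷_)) bσ)) xor u) xor (prism a b F σ xor v))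
         (prism-⊞ a b F (δ Fₐ) σ)
         (trans (δ-⊞ (Fₐ ∘ map (b ,_) ∘ (x ∷_)) (prism a b Fₐ) σ)
                (cong (_xor δ (prism a b Fₐ) σ) (δ-map (b ,_) (Fₐ ∘ ((b , x) ∷_)) σ))) ⟩
  ((F bxσ xor (Fₐ bσ xor d)) xor (prism a b F σ xor prism a b (δ Fₐ) σ))
    xor (prism a b F σ xor (d xor δ (prism a b Fₐ) σ))
    -- `d` and `prism a b F σ` are walls: they occur on both sides and cancel.
    ≡⟨ rearrange (F bxσ) (Fₐ bσ) d (prism a b F σ) (prism a b (δ Fₐ) σ) (δ (prism a b Fₐ) σ) ⟩
  (F bxσ xor Fₐ bσ) xor (prism a b (δ Fₐ) σ xor δ (prism a b Fₐ) σ)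
    ≡⟨ cong ((F bxσ xor Fₐ bσ) xor_) (prism-δ a b Fₐ σ) ⟩
  (F bxσ xor Fₐ bσ) xor (Fₐ (map (a ,_) σ) xor Fₐ bσ)
    ≡⟨ cancel (F bxσ) (Fₐ bσ) (Fₐ (map (a ,_) σ)) ⟩
  Fₐ (map (a ,_) σ) xor F bxσ ∎
  where
  open ≡-Reasoning
  bσ bxσ : List (B × A)
  bσ = map (b ,_) σ
  bxσ = map (b ,_) (x ∷ σ)
  Fₐ : Cochain (B × A)
  Fₐ = F ∘ ((a , x) ∷_)
  d : Bool
  d = δ (Fₐ ∘ ((b , x) ∷_)) bσ
  rearrange : ∀ p q d r u v →
    ((p xor (q xor d)) xor (r xor u)) xor (r xor (d xor v)) ≡ (p xor q) xor (u xor v)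
  rearrange = solve 6 (λ p q d r u v →
    ((p :+ (q :+ d)) :+ (r :+ u)) :+ (r :+ (d :+ v)) := (p :+ q) :+ (u :+ v)) refl
  cancel : ∀ p q r → (p xor q) xor (r xor q) ≡ r xor p
  cancel = solve 3 (λ p q r → (p :+ q) :+ (r :+ q) := r :+ p) refl

prism-∷ʳ : ∀ (a b : B) (F : Cochain (B × A)) (σ : List A) (x : A) →
  prism a b F (σ ∷ʳ x) ≡
  prism a b (F ∘ (_∷ʳ (b , x))) σ xor F (map (a ,_) (σ ∷ʳ x) ∷ʳ (b , x))
prism-∷ʳ a b F []      x = xor-identityʳ _
prism-∷ʳ a b F (y ∷ σ) x = trans
  (cong₂ _xor_ (cong (λ τ → F ((a , y) ∷ (b , y) ∷ τ)) (map-++ (b ,_) σ _))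
    (prism-∷ʳ a b (F ∘ ((a , y) ∷_)) σ x))
  (sym (xor-assoc (F ((a , y) ∷ (b , y) ∷ map (b ,_) σ ∷ʳ (b , x))) _ _))

-- Read backwards, a simplex that climbs from `a` to `b` over `xᵢ` passes from `b` to `a` over the
-- same vertex.
prism-reverse : ∀ (a b : B) (F : Cochain (B × A)) →
  prism a b (F ∘ reverse) ≗ prism b a F ∘ reverse
prism-reverse a b F []      = refl
prism-reverse a b F (x ∷ σ) = begin
  F (reverse ((a , x) ∷ map (b ,_) (x ∷ σ))) xor prism a b (F ∘ reverse ∘ ((a , x) ∷_)) σ
    ≡⟨ cong₂ _xor_ (cong F (unfold-reverse (a , x) (map (b ,_) (x ∷ σ))))
         (prism-cong a b (cong F ∘ unfold-reverse (a , x)) σ) ⟩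
  F (reverse (map (b ,_) (x ∷ σ)) ∷ʳ (a , x)) xor prism a b (F ∘ (_∷ʳ (a , x)) ∘ reverse) σ
    ≡⟨ cong₂ _xor_
         (cong (λ τ → F (τ ∷ʳ (a , x)))
           (trans (sym (reverse-map (b ,_) (x ∷ σ))) (cong (map (b ,_)) (unfold-reverse x σ))))
         (prism-reverse a b (F ∘ (_∷ʳ (a , x))) σ) ⟩
  F (map (b ,_) (reverse σ ∷ʳ x) ∷ʳ (a , x)) xor prism b a (F ∘ (_∷ʳ (a , x))) (reverse σ)
    ≡⟨ xor-comm (F (map (b ,_) (reverse σ ∷ʳ x) ∷ʳ (a , x))) _ ⟩
  prism b a (F ∘ (_∷ʳ (a , x))) (reverse σ) xor F (map (b ,_) (reverse σ ∷ʳ x) ∷ʳ (a , x))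
    ≡⟨ prism-∷ʳ b a F (reverse σ) x ⟨
  prism b a F (reverse σ ∷ʳ x)
    ≡⟨ cong (prism b a F) (unfold-reverse x σ) ⟨
  prism b a F (reverse (x ∷ σ)) ∎
  where open ≡-Reasoning

prism-map : ∀ {C D : Set} (f : B → D) (g : A → C) (a b : B) (F : Cochain (D × C)) →
  prism a b (F ∘ map (λ p → f (proj₁ p) , g (proj₂ p))) ≗ prism (f a) (f b) F ∘ map g
prism-map f g a b F []      = refl
prism-map f g a b F (x ∷ σ) = cong₂ _xor_
  (cong (λ τ → F ((f a , g x) ∷ (f b , g x) ∷ τ)) (trans (sym (map-∘ σ)) (map-∘ σ)))
  (prism-map f g a b (F ∘ ((f a , g x) ∷_)) σ)

-- Dual of the product with the path 0 … n.
cylinder : ∀ n → Cochain (Fin (suc n) × A) → Cochain A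
cylinder n F σ = sum λ (i : Fin n) → prism (inject₁ i) (suc i) F σ

cylinder-⊞ : ∀ n (F G : Cochain (Fin (suc n) × A)) →
  cylinder n (F ⊞ G) ≗ cylinder n F ⊞ cylinder n G
cylinder-⊞ n F G σ = trans (sum-cong-≗ λ (i : Fin n) → prism-⊞ (inject₁ i) (suc i) F G σ)
  (∑-distrib-+ (λ (i : Fin n) → prism (inject₁ i) (suc i) F σ) _)

sum-telescope : ∀ n (f : Fin (suc n) → Bool) →
  sum (λ (i : Fin n) → f (inject₁ i) xor f (suc i)) ≡ f zero xor f (fromℕ n)
sum-telescope zero    f = sym (xor-same (f zero))
sum-telescope (suc n) f = trans
  (cong ((f zero xor f (suc zero)) xor_) (sum-telescope n (f ∘ suc)))
  (cancel (f zero) (f (suc zero)) _)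
  where
  cancel : ∀ p q r → (p xor q) xor (q xor r) ≡ p xor r
  cancel = solve 3 (λ p q r → (p :+ q) :+ (q :+ r) := p :+ r) refl

δ-sum : ∀ n (F : Fin n → Cochain A) →
  δ (λ σ → sum (λ i → F i σ)) ≗ λ σ → sum (λ i → δ (F i) σ)
δ-sum zero    F σ = δ-false σ
δ-sum (suc n) F σ = trans (δ-⊞ (F zero) _ σ) (cong (δ (F zero) σ xor_) (δ-sum n (F ∘ suc) σ))

-- Summing the homotopy formula along the path cancels all inner levels.
cylinder-δ : ∀ n (F : Cochain (Fin (suc n) × A)) →
  cylinder n (δ F) ≗ F ∘ map (zero ,_) ⊞ F ∘ map (fromℕ n ,_) ⊞ δ (cylinder n F)
cylinder-δ n F σ = begin
  cylinder n (δ F) σ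
    ≡⟨ sum-cong-≗ (λ (i : Fin n) → move (prism (inject₁ i) (suc i) (δ F) σ) _ (prism-δ (inject₁ i) (suc i) F σ)) ⟩
  sum (λ (i : Fin n) → (f (inject₁ i) xor f (suc i)) xor δ (prism (inject₁ i) (suc i) F) σ)
    ≡⟨ ∑-distrib-+ (λ (i : Fin n) → f (inject₁ i) xor f (suc i)) _ ⟩
  sum (λ (i : Fin n) → f (inject₁ i) xor f (suc i)) xor sum (λ (i : Fin n) → δ (prism (inject₁ i) (suc i) F) σ)
    ≡⟨ cong₂ _xor_ (sum-telescope n f) (sym (δ-sum n (λ i → prism (inject₁ i) (suc i) F) σ)) ⟩
  (f zero xor f (fromℕ n)) xor δ (cylinder n F) σ ∎
  where
  open ≡-Reasoning
  f : Fin (suc n) → Bool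
  f i = F (map (i ,_) σ)
  move : ∀ p q {r} → p xor q ≡ r → p ≡ r xor q
  move p q refl = solve 2 (λ p q → p := (p :+ q) :+ q) refl p q

-- The antipodal map

opposite-inject₁ : ∀ {n} (i : Fin n) → opposite (inject₁ i) ≡ suc (opposite i)
opposite-inject₁ zero    = refl
opposite-inject₁ (suc i) = cong inject₁ (opposite-inject₁ i)

opposite-fromℕ : ∀ n → opposite (fromℕ n) ≡ zero
opposite-fromℕ zero    = refl
opposite-fromℕ (suc n) = cong inject₁ (opposite-fromℕ n)

-- An order-reversing map makes an increasing list decreasing; reading it backwards restores the
-- order.
antipodal : (A → A) → List A → List A
antipodal ν = reverse ∘ map ν

module _ {n : ℕ} (ν : A → A) where

  opposite×ν : Fin (suc n) × A → Fin (suc n) × A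
  opposite×ν (a , x) = opposite a , ν x

  -- Reversing the list and reversing the path each exchange the ends of an edge of the path.
  -- Together they only permute the edges, which the sum ignores.
  cylinder-antipodal : (F : Cochain (Fin (suc n) × A)) →
    cylinder n (F ∘ antipodal opposite×ν) ≗ cylinder n F ∘ antipodal ν
  cylinder-antipodal F σ = begin
    sum (λ i → prism (inject₁ i) (suc i) (F ∘ reverse ∘ map opposite×ν) σ)
      ≡⟨ sum-cong-≗ pointwise ⟩
    sum (λ i → prism (inject₁ (opposite i)) (suc (opposite i)) F (antipodal ν σ))
      ≡⟨ sum-permute (λ i → prism (inject₁ i) (suc i) F (antipodal ν σ)) reversePermutation ⟨
    sum (λ i → prism (inject₁ i) (suc i) F (antipodal ν σ)) ∎
    where
    open ≡-Reasoning
    pointwise : ∀ i → prism (inject₁ i) (suc i) (F ∘ reverse ∘ map opposite×ν) σ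
                    ≡ prism (inject₁ (opposite i)) (suc (opposite i)) F (antipodal ν σ)
    pointwise i = begin
      prism (inject₁ i) (suc i) (F ∘ reverse ∘ map opposite×ν) σ
        ≡⟨ prism-map opposite ν (inject₁ i) (suc i) (F ∘ reverse) σ ⟩
      prism (opposite (inject₁ i)) (inject₁ (opposite i)) (F ∘ reverse) (map ν σ)
        ≡⟨ prism-reverse _ _ F (map ν σ) ⟩
      prism (inject₁ (opposite i)) (opposite (inject₁ i)) F (antipodal ν σ)
        ≡⟨ cong (λ a → prism (inject₁ (opposite i)) a F (antipodal ν σ)) (opposite-inject₁ i) ⟩
      prism (inject₁ (opposite i)) (suc (opposite i)) F (antipodal ν σ) ∎

-- Hemispheres in a grid

Point : List ℕ → Set
Point []      = ⊤
Point (n ∷ N) = Fin (suc n) × Point N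

-- The central symmetry of the grid, taking each xᵢ to nᵢ - xᵢ.
ν : ∀ N → Point N → Point N
ν []      = id
ν (n ∷ N) = opposite×ν (ν N)

ν-involutive : ∀ N (x : Point N) → ν N (ν N x) ≡ x
ν-involutive []      tt      = refl
ν-involutive (n ∷ N) (a , x) = cong₂ _,_ (opposite-involutive a) (ν-involutive N x)

antipodal-involutive : ∀ N (σ : List (Point N)) → antipodal (ν N) (antipodal (ν N) σ) ≡ σ
antipodal-involutive N σ = begin
  reverse (map (ν N) (reverse (map (ν N) σ))) ≡⟨ cong reverse (reverse-map (ν N) (map (ν N) σ)) ⟩
  reverse (reverse (map (ν N) (map (ν N) σ))) ≡⟨ reverse-involutive _ ⟩
  map (ν N) (map (ν N) σ)                     ≡⟨ map-∘ σ ⟨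
  map (ν N ∘ ν N) σ                           ≡⟨ map-cong (ν-involutive N) σ ⟩
  map id σ                                    ≡⟨ map-id σ ⟩
  σ                                           ∎
  where open ≡-Reasoning

-- ev N j evaluates a cochain on a chain G j of codimension j in the grid
-- ∏ [0,nᵢ], triangulated by chains x₀ ≤ … ≤ xₖ ≤ x₀ + 1.  G 0 is the whole
-- grid, G 1 its faces with a maximal coordinate, and from codimension 2 on
-- the G j are nested hemispheres of the sphere of points having both a
-- maximal and a zero coordinate.
ev : ∀ N → ℕ → Cochain (Point N) → Bool
ev []      zero          F = F (tt ∷ [])
ev []      (suc j)       F = false
ev (n ∷ N) zero          F = ev N 0 (cylinder n F)
ev (n ∷ N) (suc zero)    F = ev N 0 (F ∘ map (fromℕ n ,_)) xor ev N 1 (cylinder n F)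
ev (n ∷ N) (suc (suc j)) F =
  ev N (1 + j) (F ∘ map (zero ,_)) xor ev N (2 + j) (cylinder n F ∘ antipodal (ν N))

-- Supports of the chains

Step : ℕ → ℕ → Set
Step a b = a ≤ b × b ≤ suc a

-- This relation is not transitive, so simplices require it of all pairs and not only of consecutive
-- vertices.
_≼_ : ∀ {N} → Point N → Point N → Set
_≼_ {[]}    _       _       = ⊤
_≼_ {n ∷ N} (a , x) (b , y) = Step (toℕ a) (toℕ b) × x ≼ y

HasMax HasZero : ∀ N → Point N → Set
HasMax  []      _       = ⊥
HasMax  (n ∷ N) (a , x) = a ≡ fromℕ n ⊎ HasMax N x
HasZero []      _       = ⊥
HasZero (n ∷ N) (a , x) = a ≡ zero ⊎ HasZero N x

-- From codimension 2 on, all chains lie on one sphere, so the condition stops changing with the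
-- codimension.
OnFace : ∀ N → ℕ → Point N → Set
OnFace N zero          x = ⊤
OnFace N (suc zero)    x = HasMax N x
OnFace N (suc (suc j)) x = HasMax N x × HasZero N x

record Supported N j (σ : List (Point N)) : Set where
  constructor supported
  field
    -- A simplex of dimension `length N` - `j` has one vertex more than its dimension.
    dimension : length σ + j ≡ suc (length N)
    ordered   : AllPairs _≼_ σ
    onFace    : All (OnFace N j) σ

Step-refl : ∀ {a} → Step a a
Step-refl = ≤-refl , n≤1+n _

≼-refl : ∀ N {x : Point N} → x ≼ x
≼-refl []      = tt
≼-refl (n ∷ N) = Step-refl , ≼-refl N

Step-∸ : ∀ n {a b} → Step a b → Step (n ∸ b) (n ∸ a)
Step-∸ n {a} {b} (a≤b , b≤1+a) = ∸-monoʳ-≤ n a≤b ,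
  ≤-trans (≤-trans (n≤1+pred (n ∸ a)) (s≤s (≤-reflexive (pred[m∸n]≡m∸[1+n] n a)))) (s≤s (∸-monoʳ-≤ n b≤1+a))
  where
  n≤1+pred : ∀ n → n ≤ suc (pred n)
  n≤1+pred zero    = z≤n
  n≤1+pred (suc n) = ≤-refl

Step-opposite : ∀ {n} (a b : Fin (suc n)) → Step (toℕ a) (toℕ b) → Step (toℕ (opposite b)) (toℕ (opposite a))
Step-opposite {n} a b p = subst₂ Step (sym (opposite-prop b)) (sym (opposite-prop a)) (Step-∸ n p)

ν-antitone : ∀ N {x y : Point N} → x ≼ y → ν N y ≼ ν N x
ν-antitone []      _       = tt
ν-antitone (n ∷ N) {a , _} {b , _} (p , q) = Step-opposite a b p , ν-antitone N q

HasMax⇒HasZero-ν : ∀ N x → HasMax N x → HasZero N (ν N x)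
HasMax⇒HasZero-ν (n ∷ N) (a , x) (inj₁ refl) = inj₁ (opposite-fromℕ n)
HasMax⇒HasZero-ν (n ∷ N) (a , x) (inj₂ p)    = inj₂ (HasMax⇒HasZero-ν N x p)

HasZero⇒HasMax-ν : ∀ N x → HasZero N x → HasMax N (ν N x)
HasZero⇒HasMax-ν (n ∷ N) (a , x) (inj₁ refl) = inj₁ refl
HasZero⇒HasMax-ν (n ∷ N) (a , x) (inj₂ p)    = inj₂ (HasZero⇒HasMax-ν N x p)

All-reverse : ∀ {A : Set} {P : A → Set} {xs} → All P xs → All P (reverse xs)
All-reverse []                     = []
All-reverse {xs = x ∷ xs} (px ∷ pxs) rewrite unfold-reverse x xs = Allₚ.∷ʳ⁺ (All-reverse pxs) px

AllPairs-reverse : ∀ {A : Set} {R : A → A → Set} {xs} → AllPairs R xs → AllPairs (flip R) (reverse xs)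
AllPairs-reverse []                       = []
AllPairs-reverse {xs = x ∷ xs} (px ∷ pxs) rewrite unfold-reverse x xs =
  AllPairsₚ.++⁺ (AllPairs-reverse pxs) ([] ∷ []) (All.map (_∷ []) (All-reverse px))

-- `ν` exchanges maximal and zero coordinates, so asking for both is symmetric, unlike the condition
-- in codimension 1.
antipodal-supported : ∀ N j {σ} → Supported N (2 + j) σ → Supported N (2 + j) (antipodal (ν N) σ)
antipodal-supported N j {σ} (supported d o f) = supported
  (trans (cong (_+ (2 + j)) (trans (length-reverse (map (ν N) σ)) (length-map (ν N) σ))) d)
  (AllPairs-reverse (AllPairsₚ.map⁺ (AllPairs.map (ν-antitone N) o)))
  (All-reverse (Allₚ.map⁺ (All.map (λ (p , q) → HasZero⇒HasMax-ν N _ q , HasMax⇒HasZero-ν N _ p) f)))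

-- Relations and predicates are arbitrary so that the induction can absorb the leading vertex: the
-- relation of the later vertices to `(a , x)` becomes part of `P′`.
prism-support : ∀ {A B : Set} (a b : B) {Q : A → A → Set} {Q′ : B × A → B × A → Set}
  {P : A → Set} {P′ : B × A → Set} →
  (∀ {x} → Q′ (a , x) (b , x)) →
  (∀ {x y} → Q x y → Q′ (a , x) (a , y) × Q′ (a , x) (b , y) × Q′ (b , x) (b , y)) →
  (∀ {x} → P x → P′ (a , x) × P′ (b , x)) →
  {F G : Cochain (B × A)} {σ : List A} → AllPairs Q σ → All P σ →
  (∀ τ → length τ ≡ suc (length σ) → AllPairs Q′ τ → All P′ τ → F τ ≡ G τ) →
  prism a b F σ ≡ prism a b G σ
prism-support a b r q p {σ = []}    _          _        e = refl
prism-support a b {Q′ = Q′} r q p {σ = x ∷ σ} (Qx ∷ Qσ) (Px ∷ Pσ) e = cong₂ _xor_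
  (e ((a , x) ∷ map (b ,_) (x ∷ σ)) (cong (λ n → suc (suc n)) (length-map (b ,_) σ))
    ((r ∷ Allₚ.map⁺ (All.map (proj₁ ∘ proj₂ ∘ q) Qx)) ∷
     Allₚ.map⁺ (All.map (proj₂ ∘ proj₂ ∘ q) Qx) ∷ AllPairsₚ.map⁺ (AllPairs.map (proj₂ ∘ proj₂ ∘ q) Qσ))
    (proj₁ (p Px) ∷ proj₂ (p Px) ∷ Allₚ.map⁺ (All.map (proj₂ ∘ p) Pσ)))
  (prism-support a b {P′ = λ z → Q′ (a , x) z × _} r q
    (λ (Qxy , Py) → (proj₁ (q Qxy) , proj₁ (p Py)) , (proj₁ (proj₂ (q Qxy)) , proj₂ (p Py)))
    Qσ (All.zip (Qx , Pσ))
    (λ τ l Qτ Pτ → e ((a , x) ∷ τ) (cong suc l) (All.map proj₁ Pτ ∷ Qτ) (proj₁ (p Px) ∷ All.map proj₂ Pτ)))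

inject₁-Step : ∀ {n} (i : Fin n) → Step (toℕ (inject₁ i)) (suc (toℕ i))
inject₁-Step i rewrite toℕ-inject₁ i = n≤1+n _ , ≤-refl

OnFace-∷ : ∀ n N j {a x} → OnFace N j x → OnFace (n ∷ N) j (a , x)
OnFace-∷ n N zero          _       = tt
OnFace-∷ n N (suc zero)    p       = inj₂ p
OnFace-∷ n N (suc (suc j)) (p , q) = inj₂ p , inj₂ q

map-supported : ∀ n N j k {a : Fin (suc n)} → (∀ {x} → OnFace N j x → OnFace (n ∷ N) k (a , x)) → k ≡ suc j →
  ∀ {σ} → Supported N j σ → Supported (n ∷ N) k (map (a ,_) σ)
map-supported n N j k {a} face refl {σ} (supported d o f) = supported
  (trans (cong (_+ suc j) (length-map (a ,_) σ)) (trans (+-suc (length σ) j) (cong suc d)))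
  (AllPairsₚ.map⁺ (AllPairs.map (λ p → Step-refl , p) o))
  (Allₚ.map⁺ (All.map face f))

cylinder-support : ∀ n N j {F G : Cochain (Point (n ∷ N))} →
  (∀ τ → Supported (n ∷ N) j τ → F τ ≡ G τ) →
  ∀ σ → Supported N j σ → cylinder n F σ ≡ cylinder n G σ
cylinder-support n N j e σ (supported d o f) = sum-cong-≗ λ (i : Fin n) →
  prism-support (inject₁ i) (suc i)
    (inject₁-Step i , ≼-refl N)
    (λ p → (Step-refl , p) , (inject₁-Step i , p) , (Step-refl , p))
    (λ p → OnFace-∷ n N j p , OnFace-∷ n N j p)
    o f λ τ l o′ f′ → e τ (supported (trans (cong (_+ j) l) (cong suc d)) o′ f′)

-- Each chain consists of supported simplices only. This lets the compatibility of labels be used on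
-- the sphere alone.
ev-support : ∀ N j {F G : Cochain (Point N)} →
  (∀ σ → Supported N j σ → F σ ≡ G σ) → ev N j F ≡ ev N j G
ev-support []      zero          e = e _ (supported refl ([] ∷ []) (tt ∷ []))
ev-support []      (suc j)       e = refl
ev-support (n ∷ N) zero          e = ev-support N 0 (cylinder-support n N 0 e)
ev-support (n ∷ N) (suc zero)    e = cong₂ _xor_
  (ev-support N 0 λ σ s → e _ (map-supported n N 0 1 (λ _ → inj₁ refl) refl s))
  (ev-support N 1 (cylinder-support n N 1 e))
ev-support (n ∷ N) (suc (suc j)) e = cong₂ _xor_
  -- The slice at `zero` supplies the zero coordinate; the maximal one comes from `N`.
  (ev-support N (1 + j) λ σ s → e _ (map-supported n N (1 + j) (2 + j) (λ p → inj₂ (top j p) , inj₁ refl) refl s))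
  (ev-support N (2 + j) λ σ s → cylinder-support n N (2 + j) e _ (antipodal-supported N j s))
  where
  top : ∀ j {x} → OnFace N (1 + j) x → HasMax N x
  top zero    p = p
  top (suc j) p = proj₁ p

-- Linearity and boundaries of the chains

ev-cong : ∀ N j {F G : Cochain (Point N)} → F ≗ G → ev N j F ≡ ev N j G
ev-cong N j e = ev-support N j λ σ _ → e σ

ev-⊞ : ∀ N j (F G : Cochain (Point N)) → ev N j (F ⊞ G) ≡ ev N j F xor ev N j G
ev-⊞ []      zero          F G = refl
ev-⊞ []      (suc j)       F G = refl
ev-⊞ (n ∷ N) zero          F G = trans (ev-cong N 0 (cylinder-⊞ n F G)) (ev-⊞ N 0 _ _)
ev-⊞ (n ∷ N) (suc zero)    F G = trans
  (cong₂ _xor_ (ev-⊞ N 0 _ _) (trans (ev-cong N 1 (cylinder-⊞ n F G)) (ev-⊞ N 1 _ _)))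
  (interchange (ev N 0 (F ∘ map (fromℕ n ,_))) (ev N 0 (G ∘ map (fromℕ n ,_))) _ _)
ev-⊞ (n ∷ N) (suc (suc j)) F G = trans
  (cong₂ _xor_ (ev-⊞ N (1 + j) _ _)
    (trans (ev-cong N (2 + j) (cylinder-⊞ n F G ∘ antipodal (ν N))) (ev-⊞ N (2 + j) _ _)))
  (interchange (ev N (1 + j) (F ∘ map (zero ,_))) (ev N (1 + j) (G ∘ map (zero ,_))) _ _)

ev-false : ∀ N j → ev N j (const false) ≡ false
ev-false N j = trans (ev-⊞ N j (const false) (const false)) (xor-same (ev N j (const false)))

-- The triangulation of the whole grid is centrally symmetric.
ev-antipodal : ∀ N (F : Cochain (Point N)) → ev N 0 (F ∘ antipodal (ν N)) ≡ ev N 0 F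
ev-antipodal []      F = refl
ev-antipodal (n ∷ N) F = trans (ev-cong N 0 (cylinder-antipodal (ν N) F)) (ev-antipodal N (cylinder n F))

antipodal-map : ∀ n N (a : Fin (suc n)) (F : Cochain (Point (n ∷ N))) →
  F ∘ antipodal (ν (n ∷ N)) ∘ map (a ,_) ≗ F ∘ map (opposite a ,_) ∘ antipodal (ν N)
antipodal-map n N a F σ = cong F (begin
  reverse (map (ν (n ∷ N)) (map (a ,_) σ))       ≡⟨ cong reverse (trans (sym (map-∘ σ)) (map-∘ σ)) ⟩
  reverse (map (opposite a ,_) (map (ν N) σ))    ≡⟨ reverse-map (opposite a ,_) (map (ν N) σ) ⟨
  map (opposite a ,_) (antipodal (ν N) σ)        ∎)
  where open ≡-Reasoning

δ-antipodal : ∀ {A : Set} (ν : A → A) (F : Cochain A) → δ F ∘ antipodal ν ≗ δ (F ∘ antipodal ν)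
δ-antipodal ν F σ = sym (trans (δ-map ν (F ∘ reverse) σ) (δ-reverse F (map ν σ)))

antipodal-map-zero : ∀ n N (F : Cochain (Point (n ∷ N))) →
  F ∘ antipodal (ν (n ∷ N)) ∘ map (zero ,_) ≗ F ∘ map (fromℕ n ,_) ∘ antipodal (ν N)
antipodal-map-zero n N = antipodal-map n N zero

antipodal-map-max : ∀ n N (F : Cochain (Point (n ∷ N))) →
  F ∘ antipodal (ν (n ∷ N)) ∘ map (fromℕ n ,_) ≗ F ∘ map (zero ,_) ∘ antipodal (ν N)
antipodal-map-max n N F σ = trans (antipodal-map n N (fromℕ n) F σ)
  (cong (λ a → F (map (a ,_) (antipodal (ν N) σ))) (opposite-fromℕ n))

-- Dually, the boundary of `G j` is `G (1 + j)` plus its antipode: a hemisphere is bounded by the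
-- two halves of the next sphere. The condition on `F []` discards the empty face of a vertex.
ev-δ : ∀ N j (F : Cochain (Point N)) → F [] ≡ false →
  ev N j (δ F) ≡ ev N (1 + j) F xor ev N (1 + j) (F ∘ antipodal (ν N))
ev-δ []      zero    F F[] = trans (xor-identityʳ _) F[]
ev-δ []      (suc j) F F[] = refl
ev-δ (n ∷ N) j F F[] = cases j
  where
  open ≡-Reasoning

  ν̂ : List (Point N) → List (Point N)
  ν̂ = antipodal (ν N)

  ν̂′ : List (Point (n ∷ N)) → List (Point (n ∷ N))
  ν̂′ = antipodal (ν (n ∷ N))

  F₀ Fₙ C : Cochain (Point N)
  F₀ = F ∘ map (zero ,_)
  Fₙ = F ∘ map (fromℕ n ,_)
  C  = cylinder n F

  C[] : C [] ≡ false
  C[] = sum-replicate-zero n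

  ev-cylinder-δ : ∀ j → ev N j (cylinder n (δ F)) ≡
    (ev N j F₀ xor ev N j Fₙ) xor (ev N (1 + j) C xor ev N (1 + j) (C ∘ ν̂))
  ev-cylinder-δ j = trans (ev-cong N j (cylinder-δ n F))
    (trans (ev-⊞ N j (F₀ ⊞ Fₙ) (δ C)) (cong₂ _xor_ (ev-⊞ N j F₀ Fₙ) (ev-δ N j C C[])))

  cases : ∀ j → ev (n ∷ N) j (δ F) ≡ ev (n ∷ N) (1 + j) F xor ev (n ∷ N) (1 + j) (F ∘ ν̂′)
  cases zero = begin
    ev N 0 (cylinder n (δ F))
      ≡⟨ ev-cylinder-δ 0 ⟩
    (ev N 0 F₀ xor ev N 0 Fₙ) xor (ev N 1 C xor ev N 1 (C ∘ ν̂))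
      ≡⟨ solve 4 (λ p q r s → (p :+ q) :+ (r :+ s) := (q :+ r) :+ (p :+ s)) refl
           (ev N 0 F₀) (ev N 0 Fₙ) (ev N 1 C) (ev N 1 (C ∘ ν̂)) ⟩
    (ev N 0 Fₙ xor ev N 1 C) xor (ev N 0 F₀ xor ev N 1 (C ∘ ν̂))
      -- The antipode of the maximal slice is the zero slice, since the whole grid on `N` is its own
      -- antipode.
      ≡⟨ cong ((ev N 0 Fₙ xor ev N 1 C) xor_) (cong₂ _xor_
           (trans (sym (ev-antipodal N F₀)) (ev-cong N 0 (sym ∘ antipodal-map-max n N F)))
           (ev-cong N 1 (sym ∘ cylinder-antipodal (ν N) F))) ⟩
    (ev N 0 Fₙ xor ev N 1 C) xor ev (n ∷ N) 1 (F ∘ ν̂′) ∎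
  cases (suc zero) = begin
    ev N 0 (δ F ∘ map (fromℕ n ,_)) xor ev N 1 (cylinder n (δ F))
      ≡⟨ cong₂ _xor_
           (trans (ev-cong N 0 (sym ∘ δ-map (fromℕ n ,_) F)) (ev-δ N 0 Fₙ F[]))
           (ev-cylinder-δ 1) ⟩
    (a xor b) xor ((c xor a) xor (d xor e))
      -- The face at n and the cylinder share the wall measured by `a`, which cancels.
      ≡⟨ solve 5 (λ a b c d e → (a :+ b) :+ ((c :+ a) :+ (d :+ e)) := (c :+ e) :+ (b :+ d)) refl a b c d e ⟩
    (c xor e) xor (b xor d)
      ≡⟨ cong ((c xor e) xor_) (cong₂ _xor_
           (ev-cong N 1 (sym ∘ antipodal-map-zero n N F))
           (ev-cong N 2 λ σ → trans (cong C (sym (antipodal-involutive N σ)))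
             (sym (cylinder-antipodal (ν N) F (ν̂ σ))))) ⟩
    (c xor e) xor ev (n ∷ N) 2 (F ∘ ν̂′) ∎
    where
    a = ev N 1 Fₙ
    b = ev N 1 (Fₙ ∘ ν̂)
    c = ev N 1 F₀
    d = ev N 2 C
    e = ev N 2 (C ∘ ν̂)
  cases (suc (suc i)) = begin
    ev N (1 + i) (δ F ∘ map (zero ,_)) xor ev N k (cylinder n (δ F) ∘ ν̂)
      ≡⟨ cong₂ _xor_
           (trans (ev-cong N (1 + i) (sym ∘ δ-map (zero ,_) F)) (ev-δ N (1 + i) F₀ F[]))
           (begin
             ev N k (cylinder n (δ F) ∘ ν̂)
               ≡⟨ ev-cong N k (λ σ → trans (cylinder-δ n F (ν̂ σ))
                    (cong ((F₀ (ν̂ σ) xor Fₙ (ν̂ σ)) xor_) (δ-antipodal (ν N) C σ))) ⟩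
             ev N k (F₀ ∘ ν̂ ⊞ Fₙ ∘ ν̂ ⊞ δ (C ∘ ν̂))
               ≡⟨ trans (ev-⊞ N k (F₀ ∘ ν̂ ⊞ Fₙ ∘ ν̂) (δ (C ∘ ν̂)))
                    (cong₂ _xor_ (ev-⊞ N k (F₀ ∘ ν̂) (Fₙ ∘ ν̂)) (ev-δ N k (C ∘ ν̂) C[])) ⟩
             (b xor c) xor (d xor e) ∎) ⟩
    (a xor b) xor ((b xor c) xor (d xor e))
      ≡⟨ solve 5 (λ a b c d e → (a :+ b) :+ ((b :+ c) :+ (d :+ e)) := (a :+ d) :+ (c :+ e)) refl a b c d e ⟩
    (a xor d) xor (c xor e)
      ≡⟨ cong ((a xor d) xor_) (cong₂ _xor_
           (ev-cong N k (sym ∘ antipodal-map-zero n N F))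
           (ev-cong N (1 + k) λ σ → sym (cylinder-antipodal (ν N) F (ν̂ σ)))) ⟩
    (a xor d) xor ev (n ∷ N) (3 + i) (F ∘ ν̂′) ∎
    where
    k = 2 + i
    a = ev N k F₀
    b = ev N k (F₀ ∘ ν̂)
    c = ev N k (Fₙ ∘ ν̂)
    d = ev N (1 + k) (C ∘ ν̂)
    e = ev N (1 + k) (C ∘ ν̂ ∘ ν̂)

ev-vanishes : ∀ N j (F : Cochain (Point N)) → length N < j → ev N j F ≡ false
ev-vanishes []      (suc j)       F _         = refl
ev-vanishes (n ∷ N) (suc (suc j)) F (s≤s N<j) = cong₂ _xor_
  (ev-vanishes N (1 + j) (F ∘ map (zero ,_)) N<j)
  (ev-vanishes N (2 + j) (cylinder n F ∘ antipodal (ν N)) (m≤n⇒m≤1+n N<j))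

-- The cylinder summand runs over a chain whose codimension exceeds the dimension of its grid, hence
-- vanishes. For nonempty `N` the vertex is (0, ..., 0, n), where n is the last side length.
ev-vertex : ∀ N → ∃[ x ] ∀ (F : Cochain (Point N)) → ev N (length N) F ≡ F (x ∷ [])
ev-vertex []           = tt , λ F → refl
ev-vertex (n ∷ [])     = (fromℕ n , tt) , λ F → xor-identityʳ _
ev-vertex (n ∷ m ∷ N) with ev-vertex (m ∷ N)
... | x , e = (zero , x) , λ F → trans
  (cong₂ _xor_ (e (F ∘ map (zero ,_)))
    (ev-vanishes (m ∷ N) (2 + length N) (cylinder n F ∘ antipodal (ν (m ∷ N))) ≤-refl))
  (xor-identityʳ _)

-- Fan's lemma

Label : ℕ → Set
Label m = Bool × Fin m

-- In the language of Fan's lemma: no complementary edge.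
Compatible : ∀ {m} → Label m → Label m → Set
Compatible (ε , c) (ε′ , c′) = c ≡ c′ → ε ≡ ε′

signsAtZero : ∀ {m} → List (Label (suc m)) → List Bool
signsAtZero []                = []
signsAtZero ((ε , zero)  ∷ L) = ε ∷ signsAtZero L
signsAtZero ((ε , suc c) ∷ L) = signsAtZero L

positivePart : ∀ {m} → List (Label (suc m)) → List (Label m)
positivePart []                = []
positivePart ((ε , zero)  ∷ L) = positivePart L
positivePart ((ε , suc c) ∷ L) = (ε , c) ∷ positivePart L

-- The last two arguments are the verdicts on the larger colours when the next expected sign is
-- still `ε`, or has been flipped by an occurrence of the smallest colour. `not (ε xor η)` tests
-- whether the two signs agree.
stage : Bool → List Bool → Bool → Bool → Bool
stage ε []          unchanged toggled = unchanged
stage ε (η ∷ [])    unchanged toggled = not (ε xor η) ∧ toggled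
stage ε (_ ∷ _ ∷ _) unchanged toggled = false

-- Whether the labels, sorted by colour, have distinct colours and alternating
-- signs, starting with ε.
alternating : ∀ m → Bool → Cochain (Label m)
alternating zero    ε L = true
alternating (suc m) ε L = stage ε (signsAtZero L)
  (alternating m ε (positivePart L)) (alternating m (not ε) (positivePart L))

alternating-[] : ∀ m ε → alternating m ε [] ≡ true
alternating-[] zero    ε = refl
alternating-[] (suc m) ε = alternating-[] m ε

alternating-length : ∀ m ε L → alternating m ε L ≡ true → length L ≤ m
alternating-length zero    ε []            _ = z≤n
alternating-length zero    ε ((_ , ()) ∷ _)
alternating-length (suc m) ε L             p = bound (signsAtZero L) (length-split L) p
  where
  length-split : ∀ {m} (L : List (Label (suc m))) →
    length L ≡ length (signsAtZero L) + length (positivePart L)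
  length-split []                = refl
  length-split ((ε , zero)  ∷ L) = cong suc (length-split L)
  length-split ((ε , suc c) ∷ L) = trans (cong suc (length-split L)) (sym (+-suc _ _))

  bound : ∀ S → length L ≡ length S + length (positivePart L) →
    stage ε S (alternating m ε (positivePart L)) (alternating m (not ε) (positivePart L)) ≡ true →
    length L ≤ suc m
  bound []       e p rewrite e = ≤-trans (alternating-length m ε _ p) (n≤1+n m)
  bound (η ∷ []) e p rewrite e with not (ε xor η)
  ... | true = s≤s (alternating-length m (not ε) _ p)

-- A product rule: the deleted label belongs to exactly one of the two sublists.
δ-split : ∀ {m} (H : List Bool → Cochain (Label m)) (L : List (Label (suc m))) →
  δ (λ L → H (signsAtZero L) (positivePart L)) L ≡
  δ (λ S → H S (positivePart L)) (signsAtZero L) xor δ (H (signsAtZero L)) (positivePart L)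
δ-split H []                = refl
δ-split H ((ε , zero)  ∷ L) = trans
  (cong (H (signsAtZero L) (positivePart L) xor_) (δ-split (H ∘ (ε ∷_)) L))
  (sym (xor-assoc (H (signsAtZero L) (positivePart L)) _ _))
δ-split H ((ε , suc c) ∷ L) = trans
  (cong (H (signsAtZero L) (positivePart L) xor_) (δ-split (λ S T → H S ((ε , c) ∷ T)) L))
  (xor-leftComm (H (signsAtZero L) (positivePart L))
    (δ (λ S → H S ((ε , c) ∷ positivePart L)) (signsAtZero L))
    (δ (λ T → H (signsAtZero L) ((ε , c) ∷ T)) (positivePart L)))

signsAtZero-constant : ∀ {m} {L : List (Label (suc m))} → AllPairs Compatible L → AllPairs _≡_ (signsAtZero L)
signsAtZero-constant {L = []}              []      = []
signsAtZero-constant {L = (ε , zero)  ∷ L} (p ∷ q) = go p ∷ signsAtZero-constant q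
  where
  go : ∀ {L} → All (Compatible (ε , zero)) L → All (ε ≡_) (signsAtZero L)
  go {[]}              []      = []
  go {(η , zero)  ∷ L} (p ∷ q) = p refl ∷ go q
  go {(η , suc c) ∷ L} (p ∷ q) = go q
signsAtZero-constant {L = (ε , suc c) ∷ L} (p ∷ q) = signsAtZero-constant q

positivePart-compatible : ∀ {m} {L : List (Label (suc m))} →
  AllPairs Compatible L → AllPairs Compatible (positivePart L)
positivePart-compatible {L = []}              []      = []
positivePart-compatible {L = (ε , zero)  ∷ L} (p ∷ q) = positivePart-compatible q
positivePart-compatible {L = (ε , suc c) ∷ L} (p ∷ q) = go p ∷ positivePart-compatible q
  where
  go : ∀ {L} → All (Compatible (ε , suc c)) L → All (Compatible (ε , c)) (positivePart L)
  go {[]}              []      = []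
  go {(η , zero)  ∷ L} (p ∷ q) = go q
  go {(η , suc d) ∷ L} (p ∷ q) = (p ∘ cong suc) ∷ go q

-- An alternating face with first sign ε is missed by the last label of a
-- simplex alternating from ε or by the first one of a simplex alternating from
-- not ε; in every other simplex such faces cancel in pairs.
δ-alternating : ∀ m ε {L} → AllPairs Compatible L →
  δ (alternating m ε) L ≡ alternating m ε L xor alternating m (not ε) L
δ-alternating zero    ε {[]}            _ = refl
δ-alternating zero    ε {(_ , ()) ∷ _}
δ-alternating (suc m) ε {L}             p = trans
  (δ-split (λ S T → stage ε S (alternating m ε T) (alternating m (not ε) T)) L)
  (staged (signsAtZero L) (signsAtZero-constant p))
  where
  T = positivePart L
  a = alternating m ε
  b = alternating m (not ε)

  δa : δ a T ≡ a T xor b T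
  δa = δ-alternating m ε (positivePart-compatible p)

  δb : δ b T ≡ b T xor a T
  δb = subst (λ η → δ b T ≡ b T xor alternating m η T) (not-involutive ε)
    (δ-alternating m (not ε) (positivePart-compatible p))

  δ-∧ : ∀ x → δ (λ T → x ∧ b T) T ≡ x ∧ δ b T
  δ-∧ true  = refl
  δ-∧ false = δ-false T

  single : ∀ ε η u v →
    (u xor false) xor (not (ε xor η) ∧ (v xor u)) ≡
    (not (ε xor η) ∧ v) xor (not (not ε xor η) ∧ u)
  single false false false false = refl
  single false false false true  = refl
  single false false true  false = refl
  single false false true  true  = refl
  single false true  false v     = refl
  single false true  true  v     = refl
  single true  false false v     = refl
  single true  false true  v     = refl
  single true  true  false false = refl
  single true  true  false true  = refl
  single true  true  true  false = refl
  single true  true  true  true  = refl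

  many : ∀ S → AllPairs _≡_ S → 2 ≤ length S → δ (λ S → stage ε S (a T) (b T)) S ≡ false
  many (x ∷ [])        _                (s≤s ())
  -- Compatibility makes the two signs equal, so both deletions leave the same list. With three or
  -- more signs, a repetition survives every deletion.
  many (x ∷ y ∷ [])    ((refl ∷ []) ∷ _) _ = trans
    (cong (s xor_) (xor-identityʳ s)) (xor-same s)
    where s = stage ε (x ∷ []) (a T) (b T)
  many (x ∷ y ∷ z ∷ S) _                _        = δ-false S

  staged : ∀ S → AllPairs _≡_ S →
    δ (λ S → stage ε S (a T) (b T)) S xor δ (λ T → stage ε S (a T) (b T)) T ≡
    stage ε S (a T) (b T) xor stage (not ε) S (b T) (alternating m (not (not ε)) T)
  staged []       _ = δa
  staged (η ∷ []) _ rewrite not-involutive ε = trans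
    (cong ((a T xor false) xor_) (trans (δ-∧ (not (ε xor η))) (cong (not (ε xor η) ∧_) δb)))
    (single ε η (a T) (b T))
  staged (x ∷ y ∷ S) q = cong₂ _xor_ (many (x ∷ y ∷ S) q (s≤s (s≤s z≤n))) (δ-false T)

-- Symmetries of alternation

opposite-label : ∀ {m} → Label m → Label m
opposite-label (ε , c) = not ε , c

stage-↭ : ∀ ε {S S′} u v → S ↭ S′ → stage ε S u v ≡ stage ε S′ u v
stage-↭ ε u v ↭.refl           = refl
stage-↭ ε u v (↭.swap x y p)   = refl
stage-↭ ε u v (↭.trans p q)    = trans (stage-↭ ε u v p) (stage-↭ ε u v q)
stage-↭ ε u v (↭.prep {[]}    {[]}    x p) = refl
stage-↭ ε u v (↭.prep {_ ∷ _} {_ ∷ _} x p) = refl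
stage-↭ ε u v (↭.prep {[]}    {_ ∷ _} x p) with () ← ↭-length p
stage-↭ ε u v (↭.prep {_ ∷ _} {[]}    x p) with () ← ↭-length p

signsAtZero-↭ : ∀ {m} {L L′ : List (Label (suc m))} → L ↭ L′ → signsAtZero L ↭ signsAtZero L′
signsAtZero-↭ ↭.refl = ↭.refl
signsAtZero-↭ (↭.prep (ε , zero)  p) = ↭.prep ε (signsAtZero-↭ p)
signsAtZero-↭ (↭.prep (ε , suc c) p) = signsAtZero-↭ p
signsAtZero-↭ (↭.swap (ε , zero)  (η , zero)  p) = ↭.swap ε η (signsAtZero-↭ p)
signsAtZero-↭ (↭.swap (ε , zero)  (η , suc _) p) = ↭.prep ε (signsAtZero-↭ p)
signsAtZero-↭ (↭.swap (ε , suc _) (η , zero)  p) = ↭.prep η (signsAtZero-↭ p)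
signsAtZero-↭ (↭.swap (ε , suc _) (η , suc _) p) = signsAtZero-↭ p
signsAtZero-↭ (↭.trans p q) = ↭.trans (signsAtZero-↭ p) (signsAtZero-↭ q)

positivePart-↭ : ∀ {m} {L L′ : List (Label (suc m))} → L ↭ L′ → positivePart L ↭ positivePart L′
positivePart-↭ ↭.refl = ↭.refl
positivePart-↭ (↭.prep (ε , zero)  p) = positivePart-↭ p
positivePart-↭ (↭.prep (ε , suc c) p) = ↭.prep (ε , c) (positivePart-↭ p)
positivePart-↭ (↭.swap (ε , zero)  (η , zero)  p) = positivePart-↭ p
positivePart-↭ (↭.swap (ε , zero)  (η , suc d) p) = ↭.prep (η , d) (positivePart-↭ p)
positivePart-↭ (↭.swap (ε , suc c) (η , zero)  p) = ↭.prep (ε , c) (positivePart-↭ p)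
positivePart-↭ (↭.swap (ε , suc c) (η , suc d) p) = ↭.swap (ε , c) (η , d) (positivePart-↭ p)
positivePart-↭ (↭.trans p q) = ↭.trans (positivePart-↭ p) (positivePart-↭ q)

-- Alternation refers to the labels sorted by colour. Needed because the antipode lists a simplex
-- backwards.
alternating-↭ : ∀ m ε {L L′} → L ↭ L′ → alternating m ε L ≡ alternating m ε L′
alternating-↭ zero    ε p = refl
alternating-↭ (suc m) ε {L} {L′} p = trans
  (stage-↭ ε _ _ (signsAtZero-↭ p))
  (cong₂ (stage ε (signsAtZero L′))
    (alternating-↭ m ε (positivePart-↭ p)) (alternating-↭ m (not ε) (positivePart-↭ p)))

signsAtZero-opposite : ∀ {m} (L : List (Label (suc m))) →
  signsAtZero (map opposite-label L) ≡ map not (signsAtZero L)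
signsAtZero-opposite []                = refl
signsAtZero-opposite ((η , zero)  ∷ L) = cong (not η ∷_) (signsAtZero-opposite L)
signsAtZero-opposite ((η , suc c) ∷ L) = signsAtZero-opposite L

positivePart-opposite : ∀ {m} (L : List (Label (suc m))) →
  positivePart (map opposite-label L) ≡ map opposite-label (positivePart L)
positivePart-opposite []                = refl
positivePart-opposite ((η , zero)  ∷ L) = positivePart-opposite L
positivePart-opposite ((η , suc c) ∷ L) = cong ((not η , c) ∷_) (positivePart-opposite L)

stage-opposite : ∀ ε S {u v} → stage ε (map not S) u v ≡ stage (not ε) S u v
stage-opposite ε []           = refl
stage-opposite ε (_ ∷ _ ∷ _)  = refl
stage-opposite ε (η ∷ []) {v = v} = cong (λ x → not x ∧ v) (xor-not ε)
  where
  xor-not : ∀ ε → ε xor not η ≡ not ε xor η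
  xor-not false = refl
  xor-not true  = not-involutive η

alternating-opposite : ∀ m ε L → alternating m ε (map opposite-label L) ≡ alternating m (not ε) L
alternating-opposite zero    ε L = refl
alternating-opposite (suc m) ε L
  rewrite signsAtZero-opposite L | positivePart-opposite L
        | alternating-opposite m ε (positivePart L)
        | alternating-opposite m (not ε) (positivePart L) =
  stage-opposite ε (signsAtZero L)

null-reverse : ∀ {A : Set} (xs : List A) → null (reverse xs) ≡ null xs
null-reverse []       = refl
null-reverse (x ∷ xs) rewrite unfold-reverse x xs = null-∷ʳ (reverse xs)
  where
  null-∷ʳ : ∀ xs → null (xs ∷ʳ x) ≡ false
  null-∷ʳ []      = refl
  null-∷ʳ (_ ∷ _) = refl

AllPairs-with : ∀ {A : Set} {P : A → Set} {R S : A → A → Set} →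
  (∀ {x y} → P x → P y → R x y → S x y) →
  ∀ {xs} → All P xs → AllPairs R xs → AllPairs S xs
AllPairs-with f []         []         = []
AllPairs-with f (px ∷ pxs) (rx ∷ rxs) =
  All.zipWith (λ (py , r) → f px py r) (pxs , rx) ∷ AllPairs-with f pxs rxs

-- The parity of the number of alternating simplices is the same for all
-- the hemispheres G j, and it is odd for the single vertex of dimension 0.
fan : ∀ N m (label : Point N → Label m) →
  (∀ x → label (ν N x) ≡ opposite-label (label x)) →
  (∀ {x y} → OnFace N 2 x → OnFace N 2 y → x ≼ y → Compatible (label x) (label y)) →
  length N ≤ suc m
fan N m label odd compatible with length N ≤? suc m
... | yes p = p
... | no  p = contradiction
  (trans (sym (Φ-true (length N ∸ 2) 0 (m∸n+n≡m (≤-trans (s≤s (s≤s z≤n)) (≰⇒> p))))) Φ-false)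
  λ ()
  where
  -- The empty list alternates vacuously, whereas `ev-δ` asks for a cochain that vanishes on it.
  alt : Bool → Cochain (Point N)
  alt ε σ = not (null σ) ∧ alternating m ε (map label σ)

  Φ : ℕ → Bool
  Φ j = ev N j (alt true ⊞ alt false)

  alt-antipodal : ∀ σ → alt true (antipodal (ν N) σ) ≡ alt false σ
  alt-antipodal σ = cong₂ _∧_
    (cong not (trans (null-reverse (map (ν N) σ)) (null-map (ν N) σ)))
    (begin
      alternating m true (map label (reverse (map (ν N) σ)))
        ≡⟨ cong (alternating m true) (reverse-map label (map (ν N) σ)) ⟩
      alternating m true (reverse (map label (map (ν N) σ)))
        ≡⟨ alternating-↭ m true (↭-reverse (map label (map (ν N) σ))) ⟩
      alternating m true (map label (map (ν N) σ))
        ≡⟨ cong (alternating m true) (trans (sym (map-∘ σ)) (trans (map-cong odd σ) (map-∘ σ))) ⟩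
      alternating m true (map opposite-label (map label σ))
        ≡⟨ alternating-opposite m true (map label σ) ⟩
      alternating m false (map label σ) ∎)
    where
    open ≡-Reasoning
    null-map : ∀ {A B : Set} (f : A → B) xs → null (map f xs) ≡ null xs
    null-map f []      = refl
    null-map f (_ ∷ _) = refl

  Φ-suc : ∀ j → 3 + j ≤ length N → Φ (2 + j) ≡ Φ (3 + j)
  Φ-suc j j<N = begin
    ev N (2 + j) (alt true ⊞ alt false)
      -- Both counts together form a coboundary, so they can be evaluated on the boundary of
      -- `G (2 + j)`: the next hemisphere and its antipode, where the signs are exchanged.
      ≡⟨ ev-support N (2 + j) (λ σ → boundary σ) ⟩
    ev N (2 + j) (δ (alt true))
      ≡⟨ ev-δ N (2 + j) (alt true) refl ⟩
    ev N (3 + j) (alt true) xor ev N (3 + j) (alt true ∘ antipodal (ν N))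
      ≡⟨ cong (ev N (3 + j) (alt true) xor_) (ev-cong N (3 + j) alt-antipodal) ⟩
    ev N (3 + j) (alt true) xor ev N (3 + j) (alt false)
      ≡⟨ ev-⊞ N (3 + j) (alt true) (alt false) ⟨
    Φ (3 + j) ∎
    where
    open ≡-Reasoning
    boundary : ∀ σ → Supported N (2 + j) σ → (alt true ⊞ alt false) σ ≡ δ (alt true) σ
    -- The simplices have at least two vertices, so no face is empty and the guard in `alt` has no
    -- effect.
    boundary []          (supported d o f) = contradiction j<N (<⇒≱ (m≤n⇒m≤1+n (≤-reflexive (sym d))))
    boundary (x ∷ [])    (supported d o f) = contradiction j<N (<⇒≱ (≤-reflexive (sym d)))
    boundary (x ∷ y ∷ σ) (supported d o f) = sym (trans
      (δ-map label (alternating m true) (x ∷ y ∷ σ))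
      (δ-alternating m true (AllPairsₚ.map⁺ (AllPairs-with compatible f o))))

  Φ-vertex : Φ (length N) ≡ true
  Φ-vertex with x , e ← ev-vertex N = begin
    ev N (length N) (alt true ⊞ alt false)
      ≡⟨ e (alt true ⊞ alt false) ⟩
    alternating m true (label x ∷ []) xor alternating m false (label x ∷ [])
      -- For a single vertex the sum over both signs is the coboundary, that is, the value on the
      -- empty face.
      ≡⟨ δ-alternating m true ([] ∷ []) ⟨
    alternating m true [] xor false
      ≡⟨ cong (_xor false) (alternating-[] m true) ⟩
    true ∎
    where open ≡-Reasoning

  Φ-true : ∀ d j → d + (2 + j) ≡ length N → Φ (2 + j) ≡ true
  Φ-true zero    j e = trans (cong Φ e) Φ-vertex
  Φ-true (suc d) j e = trans (Φ-suc j (subst (3 + j ≤_) e (s≤s (m≤n+m (2 + j) d))))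
    (Φ-true d (suc j) (trans (+-suc d (2 + j)) e))

  Φ-false : Φ 2 ≡ false
  -- A simplex of `G 2` has `length N` - 1 > `m` vertices, more than an alternating one can have.
  Φ-false = trans (ev-support N 2 λ σ s → cong₂ _xor_ (short true σ s) (short false σ s)) (ev-false N 2)
    where
    short : ∀ ε σ → Supported N 2 σ → alt ε σ ≡ false
    short ε σ s = trans (cong (not (null σ) ∧_) (¬-not λ t → p (begin
      length N               ≡⟨ suc-injective (trans (sym (Supported.dimension s)) (+-comm (length σ) 2)) ⟩
      suc (length σ)         ≡⟨ cong suc (length-map label σ) ⟨
      suc (length (map label σ)) ≤⟨ s≤s (alternating-length m ε (map label σ) t) ⟩
      suc m                  ∎))) (∧-zeroʳ (not (null σ)))
      where open ≤-Reasoning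

-- The chromatic number of W(s,t)

-- The path 0 … 2s+1 folded onto 0 … s, with a loop at s.
fold : ℕ → ℕ → ℕ
fold s p = p ⊓ (suc (2 * s) ∸ p)

fold-≤ : ∀ s p → fold s p ≤ s
fold-≤ s p with p ≤? s
... | yes p≤s = ≤-trans (m⊓n≤m p _) p≤s
... | no  p≰s = ≤-trans (m⊓n≤n p _) (m≤n+o⇒m∸n≤o (suc (2 * s)) p (begin
  suc (s + (s + 0)) ≡⟨ cong (λ n → suc (s + n)) (+-identityʳ s) ⟩
  suc s + s         ≤⟨ +-monoˡ-≤ s (≰⇒> p≰s) ⟩
  p + s             ∎))
  where open ≤-Reasoning

fold-complement : ∀ s {p q} → p + q ≡ suc (2 * s) → fold s p ≡ p ⊓ q
fold-complement s {p} {q} e = cong (p ⊓_) (trans (cong (_∸ p) (sym e)) (m+n∸m≡n p q))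

Linked : ℕ → ℕ → ℕ → Set
Linked s a b = ∣ a - b ∣ ≡ 1 ⊎ (a ≡ s × b ≡ s)

∣n-1+n∣≡1 : ∀ n → ∣ n - suc n ∣ ≡ 1
∣n-1+n∣≡1 zero    = refl
∣n-1+n∣≡1 (suc n) = ∣n-1+n∣≡1 n

∣1+n-n∣≡1 : ∀ n → ∣ suc n - n ∣ ≡ 1
∣1+n-n∣≡1 zero    = refl
∣1+n-n∣≡1 (suc n) = ∣1+n-n∣≡1 n

Linked-sym : ∀ {s a b} → Linked s a b → Linked s b a
Linked-sym {a = a} {b} (inj₁ p)       = inj₁ (trans (∣-∣-comm b a) p)
Linked-sym             (inj₂ (p , q)) = inj₂ (q , p)

double-+ : ∀ n → 2 * n ≡ n + n
double-+ n = cong (n +_) (+-identityʳ n)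

double-sum : ∀ b c → 2 * b + suc (2 * c) ≡ suc (2 * (b + c))
double-sum b c = trans (+-suc (2 * b) (2 * c)) (cong suc (sym (*-distribˡ-+ 2 b c)))

linked-fold-even : ∀ {s b c} → b ≤ c → b + c ≡ s → Linked s (fold s (2 * b)) (fold s (2 * c))
linked-fold-even {s} {b} {c} b≤c e with m≤n⇒m<n∨m≡n b≤c
-- Here 2b = s and 2b + 1 = s + 1 form the middle edge of the path, which folds to the loop.
... | inj₂ refl = inj₂ (loop , loop)
  where
  loop : fold s (2 * b) ≡ s
  loop = begin
    fold s (2 * b)       ≡⟨ fold-complement s (trans (double-sum b b) (cong (λ n → suc (2 * n)) e)) ⟩
    2 * b ⊓ suc (2 * b)  ≡⟨ m≤n⇒m⊓n≡m (n≤1+n (2 * b)) ⟩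
    2 * b                ≡⟨ double-+ b ⟩
    b + b                ≡⟨ e ⟩
    s                    ∎
    where open ≡-Reasoning
... | inj₁ b<c = subst₂ (Linked s) (sym left) (sym right) (inj₁ (∣n-1+n∣≡1 (2 * b)))
  where
  left : fold s (2 * b) ≡ 2 * b
  left = trans (fold-complement s (trans (double-sum b c) (cong (λ n → suc (2 * n)) e)))
    (m≤n⇒m⊓n≡m (m≤n⇒m≤1+n (*-monoʳ-≤ 2 b≤c)))
  right : fold s (2 * c) ≡ suc (2 * b)
  right = trans (fold-complement s (trans (double-sum c b) (cong (λ n → suc (2 * n)) (trans (+-comm c b) e))))
    (m≥n⇒m⊓n≡n (*-monoʳ-< 2 b<c))

linked-fold-odd : ∀ {s b c} → b ≤ c → suc (b + c) ≡ s → Linked s (fold s (2 * suc b)) (fold s (2 * suc c))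
linked-fold-odd {s} {b} {c} b≤c e with m≤n⇒m<n∨m≡n b≤c
... | inj₂ refl = inj₂ (loop , loop)
  where
  loop : fold s (2 * suc b) ≡ s
  loop = begin
    fold s (2 * suc b)           ≡⟨ fold-complement s (trans (double-sum (suc b) b) (cong (λ n → suc (2 * n)) e)) ⟩
    2 * suc b ⊓ suc (2 * b)      ≡⟨ m≥n⇒m⊓n≡n (≤-trans (n≤1+n _) (≤-reflexive (sym (*-suc 2 b)))) ⟩
    suc (2 * b)                  ≡⟨ cong suc (double-+ b) ⟩
    suc (b + b)                  ≡⟨ e ⟩
    s                            ∎
    where open ≡-Reasoning
... | inj₁ b<c = subst₂ (Linked s) (sym left) (sym right) (inj₁ (∣1+n-n∣≡1 (suc (2 * b))))
  where
  left : fold s (2 * suc b) ≡ 2 + 2 * b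
  left = trans (fold-complement s (trans (double-sum (suc b) c) (cong (λ n → suc (2 * n)) e)))
    (trans (m≤n⇒m⊓n≡m (m≤n⇒m≤1+n (*-monoʳ-≤ 2 b<c))) (*-suc 2 b))
  right : fold s (2 * suc c) ≡ suc (2 * b)
  right = trans (fold-complement s (trans (double-sum (suc c) b)
    (cong (λ n → suc (2 * n)) (trans (cong suc (+-comm c b)) e))))
    (m≥n⇒m⊓n≡n (≤-trans (s≤s (*-monoʳ-≤ 2 b≤c)) (≤-trans (n≤1+n _) (≤-reflexive (sym (*-suc 2 c))))))

-- Folding is invariant under p ↦ 2s + 1 - p, which takes 2c to 2b + 1 or 2b - 1, a neighbour of 2b
-- on the path.
linked-fold : ∀ {s b c} → b ≤ s → c ≤ s → b + c ≡ s ⊎ b + c ≡ suc s →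
  Linked s (fold s (2 * b)) (fold s (2 * c))
linked-fold {s} {b} {c} b≤s c≤s (inj₁ e) with ≤-total b c
... | inj₁ b≤c = linked-fold-even b≤c e
... | inj₂ c≤b = Linked-sym (linked-fold-even c≤b (trans (+-comm c b) e))
linked-fold {s} {zero}  {c}     b≤s c≤s (inj₂ refl) = contradiction c≤s 1+n≰n
linked-fold {s} {suc b} {zero}  b≤s c≤s (inj₂ e) rewrite +-identityʳ b | suc-injective e = contradiction b≤s 1+n≰n
linked-fold {s} {suc b} {suc c} b≤s c≤s (inj₂ e) with ≤-total b c
... | inj₁ b≤c = linked-fold-odd b≤c (trans (sym (+-suc b c)) (suc-injective e))
... | inj₂ c≤b = Linked-sym (linked-fold-odd c≤b
  (trans (trans (cong suc (+-comm c b)) (sym (+-suc b c))) (suc-injective e)))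

-- From grid points to vertices

foldSequence : ∀ {s t} → Sequence s t → Sequence s t
foldSequence {s} = Vec.map λ a → fromℕ< (s≤s (fold-≤ s (2 * toℕ a)))

foldSequence-at : ∀ {s t} (x : Sequence s t) i → foldSequence x at i ≡ fold s (2 * (x at i))
foldSequence-at x i = trans (cong toℕ (lookup-map i _ x)) (toℕ-fromℕ< _)

at-≤ : ∀ {s t} (x : Sequence s t) i → x at i ≤ s
at-≤ x i = toℕ≤pred[n] (lookup x i)

fold-zero : ∀ s {a} → a ≤ s → fold s (2 * a) ≡ 0 → a ≡ 0
fold-zero s {zero}  a≤s e = refl
fold-zero s {suc a} a≤s e = contradiction e
  (>⇒≢ (⊓-glb (s≤s z≤n) (m<n⇒0<n∸m (s≤s (*-monoʳ-≤ 2 a≤s)))))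

-- The position 2s is next to the end of the path, so a maximal coordinate supplies the entry 1 of a
-- vertex.
fold-double : ∀ s → 1 ≤ s → fold s (2 * s) ≡ 1
fold-double s 1≤s rewrite fold-complement s {2 * s} {1} (+-comm (2 * s) 1) = m≥n⇒m⊓n≡n (≤-trans 1≤s (m≤n*m s 2))

HasZero-mono : ∀ N {p q : Point N} → p ≼ q → HasZero N q → HasZero N p
HasZero-mono (n ∷ N) {zero  , _} _             (inj₁ refl) = inj₁ refl
HasZero-mono (n ∷ N) {suc _ , _} ((() , _) , _) (inj₁ refl)
HasZero-mono (n ∷ N)             (_ , p)       (inj₂ z)    = inj₂ (HasZero-mono N p z)

-- The mirror image of `HasZero-mono` under `ν`.
HasMax-mono : ∀ N {p q : Point N} → p ≼ q → HasMax N p → HasMax N q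
HasMax-mono N {p} {q} p≼q max = subst (HasMax N) (ν-involutive N q)
  (HasZero⇒HasMax-ν N _ (HasZero-mono N (ν-antitone N p≼q) (HasMax⇒HasZero-ν N p max)))

module _ {k : ℕ} where

  private s = suc k

  bump : Fin (suc s) → Fin (suc s)
  bump zero    = suc zero
  bump (suc a) = suc a

  -- A point of the sphere may have several zeros, a vertex only one. Nonzero entries stay, so a
  -- maximal coordinate survives.
  keepFirstZero : ∀ {t} → Sequence s t → Sequence s t
  keepFirstZero []          = []
  keepFirstZero (zero  ∷ x) = zero ∷ Vec.map bump x
  keepFirstZero (suc a ∷ x) = suc a ∷ keepFirstZero x

  Bumped : ℕ → ℕ → Set
  Bumped a b = b ≡ a ⊎ (a ≡ 0 × b ≡ 1)

  keepFirstZero-at : ∀ {t} (x : Sequence s t) i → Bumped (x at i) (keepFirstZero x at i)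
  keepFirstZero-at (zero  ∷ x) zero    = inj₁ refl
  keepFirstZero-at (zero  ∷ x) (suc i) rewrite lookup-map i bump x with lookup x i
  ... | zero  = inj₂ (refl , refl)
  ... | suc a = inj₁ refl
  keepFirstZero-at (suc a ∷ x) zero    = inj₁ refl
  keepFirstZero-at (suc a ∷ x) (suc i) = keepFirstZero-at x i

  keepFirstZero-unique : ∀ {t} (x : Sequence s t) → ∃[ i ] x at i ≡ 0 → UniqueZero (keepFirstZero x)
  keepFirstZero-unique (zero  ∷ x) _           = zero , refl ,
    λ { {zero} _ → refl ; {suc i} e → contradiction e (bumped≢0 i) }
    where
    bumped≢0 : ∀ i → Vec.map bump x at i ≢ 0
    bumped≢0 i e rewrite lookup-map i bump x with lookup x i
    bumped≢0 i () | zero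
    bumped≢0 i () | suc _
  keepFirstZero-unique (suc a ∷ x) (suc i , e) with keepFirstZero-unique x (i , e)
  ... | j , f , unique = suc j , f , λ { {suc i} e → cong suc (unique e) }

  -- An entry a stands for the even position 2a of the path; the even positions fold onto 0 ... s
  -- bijectively.
  embed : ∀ {t} → Sequence s t → Sequence s t
  embed x = foldSequence (keepFirstZero x)

  embed-isVertex : ∀ {t} (x : Sequence s t) → ∃[ i ] x at i ≡ 0 → ∃[ j ] x at j ≡ s → IsVertex (embed x)
  embed-isVertex x hasZero (j , xⱼ≡s) with keepFirstZero-unique x hasZero
  ... | i , yᵢ≡0 , unique =
    (i , trans (foldSequence-at y i) (cong (fold s ∘ (2 *_)) yᵢ≡0) ,
      λ {l} zₗ≡0 → unique (fold-zero s (at-≤ y l) (trans (sym (foldSequence-at y l)) zₗ≡0))) ,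
    (j , trans (foldSequence-at y j) (trans (cong (fold s ∘ (2 *_)) yⱼ≡s) (fold-double s (s≤s z≤n))))
    where
    y = keepFirstZero x
    yⱼ≡s : y at j ≡ s
    yⱼ≡s with keepFirstZero-at x j
    ... | inj₁ e = trans e xⱼ≡s
    ... | inj₂ (e , _) with () ← trans (sym xⱼ≡s) e

  -- Without bumps the sum is s or s + 1. A bump of one entry forces the other to be s, so it raises
  -- the sum from s to s + 1; two bumps at once would need s = 0.
  bumped-sum : ∀ {a a′ b c} → a ≤ s → Step a′ a → Bumped a b → Bumped (s ∸ a′) c →
    b + c ≡ s ⊎ b + c ≡ suc s
  bumped-sum {a} {a′} a≤s (a′≤a , a≤1+a′) (inj₁ refl) (inj₁ refl) with m≤n⇒m<n∨m≡n a′≤a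
  ... | inj₂ refl = inj₁ (m+[n∸m]≡n a≤s)
  ... | inj₁ a′<a rewrite ≤-antisym a≤1+a′ a′<a = inj₂ (cong suc (m+[n∸m]≡n (≤-trans (n≤1+n a′) a≤s)))
  bumped-sum {a} {a′} a≤s (a′≤a , a≤1+a′) (inj₁ refl) (inj₂ (e , refl))
    rewrite ≤-antisym a≤s (≤-trans (m∸n≡0⇒m≤n e) a′≤a) = inj₂ (+-comm s 1)
  bumped-sum a≤s (z≤n , _) (inj₂ (refl , refl)) (inj₁ refl) = inj₂ refl
  bumped-sum a≤s (z≤n , _) (inj₂ (refl , refl)) (inj₂ (() , _))

  embed-adjacent : ∀ {t} (x y y′ : Sequence s t) → (∀ i → Step (x at i) (y at i)) →
    (∀ i → y′ at i ≡ s ∸ x at i) → Adjacent (embed y′) (embed y)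
  embed-adjacent x y y′ step opp i
    rewrite foldSequence-at (keepFirstZero y′) i | foldSequence-at (keepFirstZero y) i =
    Linked-sym (linked-fold (at-≤ (keepFirstZero y) i) (at-≤ (keepFirstZero y′) i)
      (bumped-sum (at-≤ y i) (step i) (keepFirstZero-at y i)
        (subst (λ n → Bumped n (keepFirstZero y′ at i)) (opp i) (keepFirstZero-at y′ i))))

  toSequence : ∀ t → Point (replicate t s) → Sequence s t
  toSequence zero    _       = []
  toSequence (suc t) (a , q) = a ∷ toSequence t q

  toSequence-zero : ∀ t q → HasZero (replicate t s) q → ∃[ i ] toSequence t q at i ≡ 0
  toSequence-zero (suc t) (a , q) (inj₁ refl) = zero , refl
  toSequence-zero (suc t) (a , q) (inj₂ p) with i , e ← toSequence-zero t q p = suc i , e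

  toSequence-max : ∀ t q → HasMax (replicate t s) q → ∃[ i ] toSequence t q at i ≡ s
  toSequence-max (suc t) (a , q) (inj₁ refl) = zero , toℕ-fromℕ s
  toSequence-max (suc t) (a , q) (inj₂ p) with i , e ← toSequence-max t q p = suc i , e

  toSequence-ν : ∀ t q i → toSequence t (ν (replicate t s) q) at i ≡ s ∸ toSequence t q at i
  toSequence-ν (suc t) (a , q) zero    = opposite-prop a
  toSequence-ν (suc t) (a , q) (suc i) = toSequence-ν t q i

  toSequence-step : ∀ t {p q} → p ≼ q → ∀ i → Step (toSequence t p at i) (toSequence t q at i)
  toSequence-step (suc t) (e , _) zero    = e
  toSequence-step (suc t) (_ , p) (suc i) = toSequence-step t p i

  someVertex : ∀ {t} → 2 ≤ t → WVertex s t
  someVertex (s≤s (s≤s {n = n} _)) =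
    embed x , [ embed-isVertex x (zero , refl) (suc zero , toℕ-fromℕ s) ]
    where x = zero ∷ fromℕ s ∷ Vec.replicate n zero

  module _ {t m : ℕ} (2≤t : 2 ≤ t) (c : WVertex s t → Fin m)
    (proper : ∀ {u v} → Adjacent (value u) (value v) → c u ≢ c v) where

    private
      N = replicate t s

    vertex : Point N → WVertex s t
    vertex q with isVertex? (embed (toSequence t q))
    ... | yes p = embed (toSequence t q) , [ p ]
    -- A default off the sphere. Labels of different signs are compared only at points of the
    -- sphere, so its colour is never tested.
    ... | no  _ = someVertex 2≤t

    value-vertex : ∀ q → HasMax N q → HasZero N q → value (vertex q) ≡ embed (toSequence t q)
    value-vertex q max zer with isVertex? (embed (toSequence t q))
    ... | yes p = refl
    ... | no ¬p = contradiction
      (embed-isVertex (toSequence t q) (toSequence-zero t q zer) (toSequence-max t q max)) ¬p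

    -- The extra coordinate suspends the sphere: level 1 is coloured directly, level 0 through the
    -- antipode with the other sign, which makes the labelling odd.
    label : Point (1 ∷ N) → Label m
    label (suc zero , q) = true , c (vertex q)
    label (zero     , q) = false , c (vertex (ν N q))

    label-odd : ∀ x → label (ν (1 ∷ N) x) ≡ opposite-label (label x)
    label-odd (suc zero , q) = cong (λ q → false , c (vertex q)) (ν-involutive N q)
    label-odd (zero     , q) = refl

    label-compatible : ∀ {x y} → OnFace (1 ∷ N) 2 x → OnFace (1 ∷ N) 2 y → x ≼ y → Compatible (label x) (label y)
    label-compatible {zero     , p} {zero     , q} _ _ _ _ = refl
    label-compatible {suc zero , p} {suc zero , q} _ _ _ _ = refl
    label-compatible {suc zero , p} {zero     , q} _ _ ((() , _) , _)
    -- Level 0 is not maximal and level 1 is not zero, so `p` has a maximal and `q` a zero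
    -- coordinate. By `p≼q` each then has both.
    label-compatible {zero     , p} {suc zero , q} (inj₂ max , _) (_ , inj₂ zer) (_ , p≼q) e =
      contradiction e (proper (subst₂ Adjacent
        (sym (value-vertex (ν N p) (HasZero⇒HasMax-ν N p zer′) (HasMax⇒HasZero-ν N p max)))
        (sym (value-vertex q (HasMax-mono N p≼q max) zer))
        (embed-adjacent (toSequence t p) (toSequence t q) (toSequence t (ν N p))
          (toSequence-step t p≼q) (toSequence-ν t p))))
      where zer′ = HasZero-mono N p≼q zer

    chromatic-bound : t ≤ m
    -- The suspension coordinate accounts for the 1 in the bound of `fan`.
    chromatic-bound = s≤s⁻¹ (subst (_≤ suc m) (cong suc (length-replicate t))
      (fan (1 ∷ N) m label label-odd label-compatible))

-- An r-fold colouring of W(s,t)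

bit : Bool → ℕ
bit true  = 1
bit false = 0

count : (ℕ → Bool) → ℕ → ℕ
count f zero    = 0
count f (suc n) = bit (f 0) + count (f ∘ suc) n

count-false : ∀ n → count (λ _ → false) n ≡ 0
count-false zero    = refl
count-false (suc n) = count-false n

count-last : ∀ f n → count f (suc n) ≡ bit (f n) + count f n
count-last f zero    = refl
count-last f (suc n) = begin
  bit (f 0) + count (f ∘ suc) (suc n)               ≡⟨ cong (bit (f 0) +_) (count-last (f ∘ suc) n) ⟩
  bit (f 0) + (bit (f (suc n)) + count (f ∘ suc) n) ≡⟨ +-assoc (bit (f 0)) _ _ ⟨
  bit (f 0) + bit (f (suc n)) + count (f ∘ suc) n   ≡⟨ cong (_+ count (f ∘ suc) n) (+-comm (bit (f 0)) _) ⟩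
  bit (f (suc n)) + bit (f 0) + count (f ∘ suc) n   ≡⟨ +-assoc (bit (f (suc n))) _ _ ⟩
  bit (f (suc n)) + count f (suc n)                 ∎
  where open ≡-Reasoning

count-∨ : ∀ f g n → (∀ c → f c ≡ true → g c ≢ true) →
  count (λ c → f c ∨ g c) n ≡ count f n + count g n
count-∨ f g zero    disj = refl
count-∨ f g (suc n) disj rewrite count-∨ (f ∘ suc) (g ∘ suc) n (disj ∘ suc)
  with f 0 in f0 | g 0 in g0
... | true  | true  = contradiction g0 (disj 0 f0)
... | true  | false = refl
... | false | true  = sym (+-suc _ _)
... | false | false = refl

count-<ᵇ : ∀ g {a n} → a ≤ n → count (λ k → (k <ᵇ a) ∧ g k) n ≡ count g a
count-<ᵇ g {n = n} z≤n = count-false n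
count-<ᵇ g (s≤s a≤n)   = cong (bit (g 0) +_) (count-<ᵇ (g ∘ suc) a≤n)

∣tabulate∣ : ∀ f n → ∣ tabulate {n = n} (f ∘ toℕ) ∣ ≡ count f n
∣tabulate∣ f zero    = refl
∣tabulate∣ f (suc n) with f 0
... | true  = cong suc (∣tabulate∣ (f ∘ suc) n)
... | false = ∣tabulate∣ (f ∘ suc) n

-- reflect g o is c ↦ g (o − c), and false for c > o.
reflect : (ℕ → Bool) → ℕ → ℕ → Bool
reflect g o       zero    = g o
reflect g zero    (suc c) = false
reflect g (suc o) (suc c) = reflect g o c

reflect-true : ∀ g o c → reflect g o c ≡ true → ∃[ k ] c + k ≡ o × g k ≡ true
reflect-true g o       zero    e = o , refl , e
reflect-true g (suc o) (suc c) e with k , p , q ← reflect-true g o c e = k , cong suc p , q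

count-reflect : ∀ g o m → count (reflect g o) (suc o + m) ≡ count g (suc o)
count-reflect g zero    m = cong (bit (g 0) +_) (count-false m)
count-reflect g (suc o) m = trans (cong (bit (g (suc o)) +_) (count-reflect g o m))
  (sym (count-last g (suc o)))

-- levels v k holds iff 2v ≤ k and ⌊k/2⌋ ≡ v mod 2.
levels : ℕ → ℕ → Bool
levels zero    0                          = true
levels zero    1                          = true
levels zero    2                          = false
levels zero    3                          = false
levels zero    (suc (suc (suc (suc k)))) = levels zero k
levels (suc v) 0                          = false
levels (suc v) 1                          = false
levels (suc v) (suc (suc k))              = levels v k

levels-≥ : ∀ v k → levels v k ≡ true → v * 2 ≤ k
levels-≥ zero    k             e = z≤n
levels-≥ (suc v) (suc (suc k)) e = s≤s (s≤s (levels-≥ v k e))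

levels-parity : ∀ v k → levels v k ≡ true → levels (suc v) k ≢ true
levels-parity zero    (suc (suc (suc (suc k)))) e f = levels-parity zero k e (lower k f)
  where
  lower : ∀ k → levels zero (2 + k) ≡ true → levels 1 k ≡ true
  lower (suc (suc k)) f = f
levels-parity (suc v) (suc (suc k))             e f = levels-parity v k e f

-- The halves of 2m + 1 and 2m + 2 have opposite parities, so once 2v is reached, raising `m` by one
-- admits exactly one more number.
count-levels : ∀ v m → count (levels v) (suc (m * 2)) ≡ suc m ∸ v
count-levels zero          zero          = refl
count-levels zero          (suc zero)    = refl
count-levels zero          (suc (suc m)) = cong (2 +_) (count-levels zero m)
count-levels (suc zero)    zero          = refl
count-levels (suc (suc v)) zero          = refl
count-levels (suc v)       (suc m)       = count-levels v m

-- The bound k ≤ 2ρ - 2, in a form that excludes every k when ρ = 0.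
band : ℕ → ℕ → ℕ → Bool
band ρ v k = (k <ᵇ pred (ρ * 2)) ∧ levels v k

band-true : ∀ ρ v k → band ρ v k ≡ true → 2 + k ≤ ρ * 2 × levels v k ≡ true
band-true (suc ρ) v k e with k <ᵇ suc (ρ * 2) in lt
... | true = s≤s (<ᵇ⇒< k (suc (ρ * 2)) (Equivalence.from T-≡ lt)) , e

count-band : ∀ ρ v {n} → pred (ρ * 2) ≤ n → count (band ρ v) n ≡ ρ ∸ v
count-band zero    v {n} _ = trans (count-false n) (sym (0∸n≡0 v))
count-band (suc ρ) v     b = trans (count-<ᵇ (levels v) b) (count-levels v ρ)

-- The colour i − k is shifted to o + i − k, which is not negative for o ≥ 2r − 2.
palette : ∀ {s t} → ℕ → ℕ → Sequence s t → ℕ → Bool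
palette o ρ []      c = false
palette o ρ (v ∷ x) c = reflect (band ρ (toℕ v)) o c ∨ palette (suc o) (toℕ v ⊓ ρ) x c

-- `bounded` and `earlier` together say k ≤ 2ρᵢ - 2, with ρᵢ unfolded as the minimum of ρ and the
-- entries before position i.
record Uses {s t} (o ρ : ℕ) (x : Sequence s t) (c : ℕ) : Set where
  constructor uses
  field
    position : Fin t
    offset   : ℕ
    colour≡  : c + offset ≡ o + toℕ position
    level    : levels (x at position) offset ≡ true
    bounded  : 2 + offset ≤ ρ * 2
    earlier  : ∀ j → toℕ j < toℕ position → 2 + offset ≤ x at j * 2

palette-uses : ∀ {s t} o ρ (x : Sequence s t) c → palette o ρ x c ≡ true → Uses o ρ x c
palette-uses o ρ (v ∷ x) c e with reflect (band ρ (toℕ v)) o c in h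
... | true  with k , p , q ← reflect-true (band ρ (toℕ v)) o c h with b , l ← band-true ρ (toℕ v) k q =
  uses zero k (trans p (sym (+-identityʳ o))) l b λ _ ()
... | false with uses i k p l b f ← palette-uses (suc o) (toℕ v ⊓ ρ) x c e =
  uses (suc i) k (trans p (sym (+-suc o (toℕ i)))) l
    (≤-trans b (*-monoˡ-≤ 2 (m⊓n≤n (toℕ v) ρ)))
    λ { zero    _         → ≤-trans b (*-monoˡ-≤ 2 (m⊓n≤m (toℕ v) ρ))
      ; (suc j) (s≤s j<i) → f j j<i }

minimum : ∀ {s t} → ℕ → Sequence s t → ℕ
minimum ρ []      = ρ
minimum ρ (v ∷ x) = minimum (toℕ v ⊓ ρ) x

minimum-zero : ∀ {s t} ρ (x : Sequence s t) → ∃[ i ] x at i ≡ 0 → minimum ρ x ≡ 0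
minimum-zero ρ (v ∷ x) (zero  , e) rewrite e = from-zero x
  where
  from-zero : ∀ {s t} (x : Sequence s t) → minimum 0 x ≡ 0
  from-zero []      = refl
  from-zero (v ∷ x) rewrite ⊓-zeroʳ (toℕ v) = from-zero x
minimum-zero ρ (v ∷ x) (suc i , e) = minimum-zero (toℕ v ⊓ ρ) x (i , e)

-- At a later position the same colour needs a larger offset, but there offsets are at most 2a - 2,
-- while at the first position they are at least 2a.
reflect-palette-disjoint : ∀ {s t} o ρ a (x : Sequence s t) c →
  reflect (band ρ a) o c ≡ true → palette (suc o) (a ⊓ ρ) x c ≢ true
reflect-palette-disjoint o ρ a x c p q
  with k , k≡ , e ← reflect-true (band ρ a) o c p
  with uses i k′ k′≡ _ b′ _ ← palette-uses (suc o) (a ⊓ ρ) x c q = <-irrefl refl (begin-strict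
    k           <⟨ +-cancelˡ-< c k k′ (subst₂ _<_ (sym k≡) (sym k′≡) (s≤s (m≤m+n o (toℕ i)))) ⟩
    k′          ≤⟨ m≤n+m k′ 2 ⟩
    2 + k′      ≤⟨ b′ ⟩
    (a ⊓ ρ) * 2 ≤⟨ *-monoˡ-≤ 2 (m⊓n≤m a ρ) ⟩
    a * 2       ≤⟨ levels-≥ a k (proj₂ (band-true ρ a k e)) ⟩
    k           ∎)
  where open ≤-Reasoning

-- A telescoping sum: the first position contributes the drop from ρ to `toℕ v ⊓ ρ`. The hypothesis
-- keeps offsets at most `o`, so that no colour is cut off.
count-palette : ∀ {s t} o ρ (x : Sequence s t) → ρ * 2 ≤ 2 + o →
  count (palette o ρ x) (t + o) + minimum ρ x ≡ ρ
count-palette o ρ []      _ = cong (_+ ρ) (count-false o)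
count-palette {t = suc t} o ρ (v ∷ x) b = begin
  count (palette o ρ (v ∷ x)) (suc t + o) + minimum ρ′ x
    ≡⟨ cong (_+ minimum ρ′ x) (count-∨ (reflect (band ρ a) o) (palette (suc o) ρ′ x) (suc t + o)
         (reflect-palette-disjoint o ρ a x)) ⟩
  count (reflect (band ρ a) o) (suc t + o) + count (palette (suc o) ρ′ x) (suc t + o) + minimum ρ′ x
    ≡⟨ cong₂ (λ m n → m + n + minimum ρ′ x)
         (begin
           count (reflect (band ρ a) o) (suc t + o) ≡⟨ cong (count (reflect (band ρ a) o) ∘ suc) (+-comm t o) ⟩
           count (reflect (band ρ a) o) (suc o + t) ≡⟨ count-reflect (band ρ a) o t ⟩
           count (band ρ a) (suc o)                 ≡⟨ count-band ρ a (pred-mono-≤ b) ⟩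
           ρ ∸ a                                    ∎)
         (cong (count (palette (suc o) ρ′ x)) (sym (+-suc t o))) ⟩
  ρ ∸ a + count (palette (suc o) ρ′ x) (t + suc o) + minimum ρ′ x
    ≡⟨ +-assoc (ρ ∸ a) _ _ ⟩
  ρ ∸ a + (count (palette (suc o) ρ′ x) (t + suc o) + minimum ρ′ x)
    ≡⟨ cong (ρ ∸ a +_) (count-palette (suc o) ρ′ x
         (≤-trans (*-monoˡ-≤ 2 (m⊓n≤n a ρ)) (m≤n⇒m≤1+n b))) ⟩
  ρ ∸ a + ρ′
    ≡⟨ +-comm (ρ ∸ a) ρ′ ⟩
  ρ′ + (ρ ∸ a)
    ≡⟨ m⊓n+n∸m≡n a ρ ⟩
  ρ ∎
  where
  open ≡-Reasoning
  a  = toℕ v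
  ρ′ = a ⊓ ρ

-- Disjointness for adjacent vertices

adjacent-≤ : ∀ {s t} {x y : Sequence s t} → Adjacent x y → ∀ i → y at i ≤ suc (x at i)
adjacent-≤ {x = x} {y} adj i with adj i
... | inj₂ (e , f) rewrite e | f = n≤1+n _
... | inj₁ e = begin
  y at i                            ≤⟨ m≤n+∣m-n∣ (y at i) (x at i) ⟩
  x at i + ∣ y at i - x at i ∣      ≡⟨ cong (x at i +_) (trans (∣-∣-comm (y at i) (x at i)) e) ⟩
  x at i + 1                        ≡⟨ +-comm (x at i) 1 ⟩
  suc (x at i)                      ∎
  where open ≤-Reasoning

∣m-n∣≡1⇒consecutive : ∀ m n → ∣ m - n ∣ ≡ 1 → n ≡ suc m ⊎ m ≡ suc n
∣m-n∣≡1⇒consecutive zero    n       refl = inj₁ refl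
∣m-n∣≡1⇒consecutive (suc m) zero    e    = inj₂ e
∣m-n∣≡1⇒consecutive (suc m) (suc n) e    with ∣m-n∣≡1⇒consecutive m n e
... | inj₁ refl = inj₁ refl
... | inj₂ refl = inj₂ refl

module _ {s t o ρ c : ℕ} {x y : Sequence s t} (adj : Adjacent x y) where

  uses-position-≮ : (u : Uses o ρ x c) (v : Uses o ρ y c) → ¬ toℕ (Uses.position u) < toℕ (Uses.position v)
  uses-position-≮ (uses i k k≡ l _ _) (uses i′ k′ k′≡ _ _ f′) i<i′ = <-irrefl refl (begin-strict
    2 + k           <⟨ +-monoʳ-< 2 (+-cancelˡ-< c k k′ (subst₂ _<_ (sym k≡) (sym k′≡) (+-monoʳ-< o i<i′))) ⟩
    2 + k′          ≤⟨ f′ i i<i′ ⟩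
    y at i * 2      ≤⟨ *-monoˡ-≤ 2 (adjacent-≤ {x = x} {y} adj i) ⟩
    2 + x at i * 2  ≤⟨ +-monoʳ-≤ 2 (levels-≥ (x at i) k l) ⟩
    2 + k           ∎)
    where open ≤-Reasoning

  uses-position-≢ : ρ ≤ s → (u : Uses o ρ x c) (v : Uses o ρ y c) → toℕ (Uses.position u) ≢ toℕ (Uses.position v)
  uses-position-≢ ρ≤s (uses i k k≡ l b _) (uses i′ k′ k′≡ l′ _ _) i≡i′
    with refl ← toℕ-injective i≡i′
    with refl ← +-cancelˡ-≡ c k k′ (trans k≡ (sym k′≡))
    with adj i
  -- At a loop the entry s ≥ ρ leaves no offset between 2s and 2ρ - 2.
  ... | inj₂ (e , _) = <-irrefl refl (begin-strict
    k          <⟨ m<n⇒m<1+n ≤-refl ⟩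
    2 + k      ≤⟨ b ⟩
    ρ * 2      ≤⟨ *-monoˡ-≤ 2 ρ≤s ⟩
    s * 2      ≡⟨ cong (_* 2) e ⟨
    x at i * 2 ≤⟨ levels-≥ (x at i) k l ⟩
    k          ∎)
    where open ≤-Reasoning
  ... | inj₁ e with ∣m-n∣≡1⇒consecutive (x at i) (y at i) e
  ...   | inj₁ yᵢ≡1+xᵢ = levels-parity (x at i) k l (subst (λ a → levels a k ≡ true) yᵢ≡1+xᵢ l′)
  ...   | inj₂ xᵢ≡1+yᵢ = levels-parity (y at i) k l′ (subst (λ a → levels a k ≡ true) xᵢ≡1+yᵢ l)

palette-disjoint : ∀ {s t o ρ} {x y : Sequence s t} → ρ ≤ s → Adjacent x y →
  ∀ c → palette o ρ x c ≡ true → palette o ρ y c ≢ true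
palette-disjoint {o = o} {ρ} {x} {y} ρ≤s adj c p q
  with u ← palette-uses o ρ x c p | v ← palette-uses o ρ y c q
  with <-cmp (toℕ (Uses.position u)) (toℕ (Uses.position v))
... | tri< i<i′ _ _ = uses-position-≮ adj u v i<i′
... | tri≈ _ i≡i′ _ = uses-position-≢ adj ρ≤s u v i≡i′
... | tri> _ _ i′<i = uses-position-≮ (adjacent-sym {x = x} {y} adj) v u i′<i

multicolouring : ∀ {s t} k → suc k ≤ s → Multicolouring (W s t) (suc k) (t + 2 * k)
multicolouring {s} {t} k r≤s = record
  { colours  = λ v → tabulate (colour v ∘ toℕ)
  ; size     = λ { v@(x , [ p ]) → trans (∣tabulate∣ (colour v) (t + o)) (size v (zeroOf v)) }
  ; disjoint = λ { {u} {v} u~v (c , c∈) → let p , q = x∈p∩q⁻ _ _ c∈ in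
      palette-disjoint {o = o} {x = value u} {value v} r≤s u~v (toℕ c) (member u c p) (member v c q) }
  }
  where
  r = suc k
  o = 2 * k

  colour : WVertex s t → ℕ → Bool
  colour v = palette o r (value v)

  member : ∀ v (c : Fin (t + o)) → c ∈ tabulate (colour v ∘ toℕ) → colour v (toℕ c) ≡ true
  member v c c∈ = trans (sym (lookup∘tabulate (colour v ∘ toℕ) c)) ([]=⇒lookup c∈)

  zeroOf : ∀ v → ∃[ i ] value v at i ≡ 0
  zeroOf (x , [ p ]) with (i , e , _) , _ ← recompute (isVertex? x) p = i , e

  size : ∀ v → ∃[ i ] value v at i ≡ 0 → count (colour v) (t + o) ≡ r
  size v hasZero = begin
    count (colour v) (t + o)
      ≡⟨ +-identityʳ _ ⟨
    count (colour v) (t + o) + 0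
      ≡⟨ cong (count (colour v) (t + o) +_) (minimum-zero r (value v) hasZero) ⟨
    count (colour v) (t + o) + minimum r (value v)
      ≡⟨ count-palette o r (value v) (≤-reflexive (cong (2 +_) (*-comm k 2))) ⟩
    r ∎
    where open ≡-Reasoning

-- From r-fold colourings to colourings

first : ∀ {n} → Subset n → ℕ
first []          = 0
first (true  ∷ A) = 0
first (false ∷ A) = suc (first A)

-- A common least element would lie in both sets. Hence both are empty, which `first` marks by the
-- value `n`.
disjoint-first≡ : ∀ {n} (A B : Subset n) → Empty (A ∩ B) → first A ≡ first B → n ≤ first A
disjoint-first≡ []          []          dis e = z≤n
disjoint-first≡ (true  ∷ A) (true  ∷ B) dis e = contradiction (zero , here) dis
disjoint-first≡ (false ∷ A) (false ∷ B) dis e = s≤s (disjoint-first≡ A B (drop-∷-Empty dis) (suc-injective e))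

-- The two sets and the initial segment below both of them are pairwise disjoint.
disjoint-size : ∀ {n} (A B : Subset n) → Empty (A ∩ B) → ∣ A ∣ + ∣ B ∣ + (first A ⊓ first B) ≤ n
disjoint-size []          []          dis = z≤n
disjoint-size (true  ∷ A) (true  ∷ B) dis = contradiction (zero , here) dis
disjoint-size (true  ∷ A) (false ∷ B) dis = s≤s (begin
  ∣ A ∣ + ∣ B ∣ + 0                     ≤⟨ +-monoʳ-≤ (∣ A ∣ + ∣ B ∣) z≤n ⟩
  ∣ A ∣ + ∣ B ∣ + (first A ⊓ first B)   ≤⟨ disjoint-size A B (drop-∷-Empty dis) ⟩
  _                                     ∎)
  where open ≤-Reasoning
disjoint-size {suc n} (false ∷ A) (true  ∷ B) dis = begin
  ∣ A ∣ + suc ∣ B ∣ + 0                       ≡⟨ cong (_+ 0) (+-suc ∣ A ∣ ∣ B ∣) ⟩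
  suc (∣ A ∣ + ∣ B ∣ + 0)                     ≤⟨ s≤s (+-monoʳ-≤ (∣ A ∣ + ∣ B ∣) z≤n) ⟩
  suc (∣ A ∣ + ∣ B ∣ + (first A ⊓ first B))   ≤⟨ s≤s (disjoint-size A B (drop-∷-Empty dis)) ⟩
  suc n                                       ∎
  where open ≤-Reasoning
disjoint-size {suc n} (false ∷ A) (false ∷ B) dis = begin
  ∣ A ∣ + ∣ B ∣ + suc (first A ⊓ first B)     ≡⟨ +-suc (∣ A ∣ + ∣ B ∣) _ ⟩
  suc (∣ A ∣ + ∣ B ∣ + (first A ⊓ first B))   ≤⟨ s≤s (disjoint-size A B (drop-∷-Empty dis)) ⟩
  suc n                                       ∎
  where open ≤-Reasoning

kneserColour : ∀ {n} M → Subset n → Fin (suc M)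
kneserColour M A = fromℕ< (s≤s (m⊓n≤n (first A) M))

kneserColour-first : ∀ {n} M (A B : Subset n) → kneserColour M A ≡ kneserColour M B →
  first A ⊓ M ≡ first B ⊓ M
kneserColour-first M A B e = trans (sym (toℕ-fromℕ< _)) (trans (cong toℕ e) (toℕ-fromℕ< _))

-- Two sets avoiding the first n − k elements and of total size k + 1 meet.
kneserColour-proper : ∀ {n} k (A B : Subset n) → Empty (A ∩ B) → ∣ A ∣ + ∣ B ∣ ≡ suc k →
  kneserColour (n ∸ k) A ≢ kneserColour (n ∸ k) B
kneserColour-proper {n} k A B dis size e with n ∸ k ≤? first A | n ∸ k ≤? first B
... | yes M≤A | yes M≤B = <-irrefl refl (begin-strict
  n                                       ≤⟨ m≤n+m∸n n k ⟩
  k + (n ∸ k)                             <⟨ ≤-refl ⟩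
  suc k + (n ∸ k)                         ≡⟨ cong (_+ (n ∸ k)) size ⟨
  ∣ A ∣ + ∣ B ∣ + (n ∸ k)                 ≤⟨ +-monoʳ-≤ (∣ A ∣ + ∣ B ∣) (⊓-glb M≤A M≤B) ⟩
  ∣ A ∣ + ∣ B ∣ + (first A ⊓ first B)     ≤⟨ disjoint-size A B dis ⟩
  n                                       ∎)
  where open ≤-Reasoning
... | yes M≤A | no  M≰B = M≰B (≤-trans
  (≤-reflexive (trans (sym (m≥n⇒m⊓n≡n M≤A)) (kneserColour-first (n ∸ k) A B e)))
  (m⊓n≤m (first B) (n ∸ k)))
... | no  M≰A | yes M≤B = M≰A (≤-trans
  (≤-reflexive (trans (sym (m≥n⇒m⊓n≡n M≤B)) (sym (kneserColour-first (n ∸ k) A B e))))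
  (m⊓n≤m (first A) (n ∸ k)))
... | no  M≰A | no  M≰B = M≰A (≤-trans (m∸n≤m n k) (disjoint-first≡ A B dis (begin
  first A             ≡⟨ m≤n⇒m⊓n≡m (≰⇒≥ M≰A) ⟨
  first A ⊓ (n ∸ k)   ≡⟨ kneserColour-first (n ∸ k) A B e ⟩
  first B ⊓ (n ∸ k)   ≡⟨ m≤n⇒m⊓n≡m (≰⇒≥ M≰B) ⟩
  first B             ∎)))
  where open ≡-Reasoning

-- The lower bound for r-fold colourings

multicolouring-chromatic : ∀ {s t} r n → 1 ≤ s → 2 ≤ t →
  Multicolouring (W s t) (suc r) n → t ≤ suc (n ∸ suc (2 * r))
multicolouring-chromatic {suc s} r n 1≤s 2≤t M =
  -- The sets have `suc r` elements, so two disjoint ones have `suc (2 * r)` + 1 in total, as the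
  -- Kneser colouring requires.
  chromatic-bound 2≤t (kneserColour (n ∸ suc (2 * r)) ∘ colours) λ {u} {v} u~v →
    kneserColour-proper (suc (2 * r)) (colours u) (colours v) (disjoint u~v) (begin
      ∣ colours u ∣ + ∣ colours v ∣ ≡⟨ cong₂ _+_ (size u) (size v) ⟩
      suc r + suc r                 ≡⟨ cong suc (+-suc r r) ⟩
      2 + (r + r)                   ≡⟨ cong (2 +_) (double-+ r) ⟨
      2 + 2 * r                     ∎)
  where
  open Multicolouring M
  open ≡-Reasoning

multicolouring-bound : ∀ {s t} r n → 1 ≤ s → 2 ≤ t →
  Multicolouring (W s t) (suc r) n → t + 2 * r ≤ n
multicolouring-bound {s} {t} r n 1≤s 2≤t M with suc (2 * r) ≤? n | multicolouring-chromatic r n 1≤s 2≤t M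
... | yes k≤n | t≤ = begin
  t + 2 * r                             ≤⟨ +-monoˡ-≤ (2 * r) t≤ ⟩
  suc (n ∸ suc (2 * r)) + 2 * r         ≡⟨ +-suc (n ∸ suc (2 * r)) (2 * r) ⟨
  n ∸ suc (2 * r) + suc (2 * r)         ≡⟨ m∸n+n≡m k≤n ⟩
  n                                     ∎
  where open ≤-Reasoning
-- The subtraction truncates to 0, which would leave a single colour, against t ≥ 2.
... | no  k≰n | t≤ = contradiction
  (subst (λ m → 2 ≤ suc m) (m≤n⇒m∸n≡0 (≰⇒≥ k≰n)) (≤-trans 2≤t t≤))
  λ { (s≤s ()) }

corollary4 : ∀ (r s t : ℕ) → 1 ≤ r → r ≤ s → 2 ≤ t →
    MultichromaticNumber (W s t) r (t + 2 * (r ∸ 1))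
corollary4 r@(suc k) s t 1≤r r≤s 2≤t = record
  { attained = multicolouring k r≤s
  ; minimal  = λ n → multicolouring-bound k n (≤-trans 1≤r r≤s) 2≤t
  }
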